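{- For integers $1\le m\le n$ let $$H_{n,m}(t,u)=\sum_{\substack{\mathbf w\in \mathrm{PF}_n\\ \max_i w_i\le m}} t^{\mathrm{pk}(\mathbf w)}u^{\mathrm{tie}(\mathbf w)}.$$ Then for $2\le m\le n$, $$H_{n,m}(t,u)=H_{n,m-1}(t,u)+\sum_{r=1}^{n-m+1}\bigl(\mathcal I_{n-r,r}H_{n-r,m-1}\bigr)(t,u),$$ with initial condition $H_{n,1}(t,u)=u^{n-1}$, where $\mathcal I_{\ell,r}$ is the insertion operator given by $$\bigl(\mathcal I_{\ell,r}F\bigr)(t,u)=[z^r]\,\mathcal E^2\mathcal A^{\ell-1}F\!\left(\frac{\mathcal B}{\mathcal A^2},\frac{\mathcal C}{\mathcal A}\right),\qquad F\in\mathbb R[t,u],$$ with $$\mathcal E=1+\frac{z}{1-uz},\quad \mathcal A=1+tz+\frac{uz^2}{1-uz},\quad \mathcal C=u+tz+\frac{uz^2}{1-uz},\quad \mathcal B=\mathcal A^2+t-1.$$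
   Context: A parking function of length $n$ is a word $\mathbf w=(w_1,\dots,w_n)\in[n]^n$, $[n]=\{1,\dots,n\}$, whose nondecreasing rearrangement $b_1\le\dots\le b_n$ satisfies $b_i\le i$ for all $i$; $\mathrm{PF}_n$ is the set of these. For a word $\mathbf w$ of length $n$: $\mathrm{tie}(\mathbf w)$ is the number of $i\in[n-1]$ with $w_i=w_{i+1}$; $\mathrm{pk}(\mathbf w)$ is the number of strict peaks, i.e. of indices $2\le i\le n-1$ with $w_{i-1}<w_i>w_{i+1}$. The insertion operator $\mathcal I_{\ell,r}\colon\mathbb R[t,u]\to\mathbb R[t,u]$ is defined for $\ell\ge1$, $r\ge0$. All series are formal power series in $z$ with coefficients in $\mathbb R[t,u]$ ($\mathcal A$ has constant term $1$ in $z$, hence is invertible), and $[z^r]$ extracts the coefficient of $z^r$. -}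

module Defs where

open import Algebra.Bundles using (CommutativeRing; RawRing)
open import Algebra.Morphism.Structures using (module RingMorphisms)
import Algebra.Morphism.RingMonomorphism as RingMonomorphism
import Algebra.Properties.Ring as RingProperties
import Algebra.Properties.Semiring.Exp as Exp
import Algebra.Properties.Semiring.Sum as Sum
open import Data.Bool.Base using (if_then_else_)
open import Data.Fin.Base as Fin using (toℕ)
open import Data.List.Base
  using (List; []; _∷_; map; foldr; filter; upTo; cartesianProductWith)
open import Data.List.Extrema.Nat using (max)
open import Data.List.Relation.Binary.Pointwise as Pointwise using (Pointwise)
open import Data.Nat.Base as ℕ using (ℕ; zero; suc; _∸_; _≤_; _<_; z≤n; s≤s)
import Data.Nat.Properties as ℕₚ
open import Data.List.Sort ℕₚ.≤-decTotalOrder using (sort)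
open import Data.Product.Base using (_,_)
open import Function.Base using (_∘_)
open import Level using (Level)
open import Relation.Binary.Structures using (IsEquivalence)
import Relation.Binary.Reasoning.Setoid as ≈-Reasoning
open import Relation.Nullary.Decidable using (Dec; does; _×-dec_)
open import Relation.Unary using (Decidable)

private
  variable
    c ℓ c′ ℓ′ : Level

module PowerSeries (R : CommutativeRing c ℓ) where

  private
    module R = CommutativeRing R
  open R using (_≈_; _+_; _*_; -_; 0#; 1#)
  open Sum R.semiring using (sum⁺-syntax)

  -- f n is the coefficient of zⁿ.
  Series : Set c
  Series = ℕ → R.Carrier

  infix 4 _≋_
  record _≋_ (f g : Series) : Set ℓ where
    constructor coeffwise
    field coeff-≈ : ∀ n → f n ≈ g n
  open _≋_ public

  const : R.Carrier → Series
  const a zero    = a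
  const a (suc _) = 0#

  z : Series
  z 1 = 1#
  z _ = 0#

  infixl 6 _⊕_
  infixl 7 _⊛_

  _⊕_ : Series → Series → Series
  (f ⊕ g) n = f n + g n

  ⊝_ : Series → Series
  (⊝ f) n = - f n

  _⊛_ : Series → Series → Series
  (f ⊛ g) n = ∑[ i ≤ n ] (f (toℕ i) * g (n ∸ toℕ i))

  private
    open ≈-Reasoning R.setoid

    -- (f ⊛ g) (suc n) is definitionally f 0 * g (suc n) + (tail f ⊛ g) n.
    tail : Series → Series
    tail f n = f (suc n)

    ⊛-cong-at : ∀ f f′ g g′ n → (∀ j → f j ≈ f′ j) → (∀ j → j ≤ n → g j ≈ g′ j) →
                (f ⊛ g) n ≈ (f′ ⊛ g′) n
    ⊛-cong-at f f′ g g′ zero    p q = R.+-congʳ (R.*-cong (p 0) (q 0 z≤n))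
    ⊛-cong-at f f′ g g′ (suc n) p q = R.+-cong
      (R.*-cong (p 0) (q (suc n) ℕₚ.≤-refl))
      (⊛-cong-at (tail f) (tail f′) g g′ n (p ∘ suc) λ j j≤n → q j (ℕₚ.m≤n⇒m≤1+n j≤n))

    ⊛-cong : ∀ {f f′ g g′} → f ≋ f′ → g ≋ g′ → f ⊛ g ≋ f′ ⊛ g′
    ⊛-cong {f} {f′} {g} {g′} p q =
      coeffwise λ n → ⊛-cong-at f f′ g g′ n (coeff-≈ p) λ j _ → coeff-≈ q j

    interchange : ∀ a b x y → (a + b) + (x + y) ≈ (a + x) + (b + y)
    interchange a b x y = begin
      (a + b) + (x + y) ≈⟨ R.+-assoc a b (x + y) ⟩
      a + (b + (x + y)) ≈⟨ R.+-congˡ (R.+-assoc b x y) ⟨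
      a + ((b + x) + y) ≈⟨ R.+-congˡ (R.+-congʳ (R.+-comm b x)) ⟩
      a + ((x + b) + y) ≈⟨ R.+-congˡ (R.+-assoc x b y) ⟩
      a + (x + (b + y)) ≈⟨ R.+-assoc a x (b + y) ⟨
      (a + x) + (b + y) ∎

    swap : ∀ a b x → a + (b + x) ≈ b + (a + x)
    swap a b x = begin
      a + (b + x) ≈⟨ R.+-assoc a b x ⟨
      (a + b) + x ≈⟨ R.+-congʳ (R.+-comm a b) ⟩
      (b + a) + x ≈⟨ R.+-assoc b a x ⟩
      b + (a + x) ∎

    ⊛-suc : ∀ f g n → (f ⊛ g) (suc n) ≈ f (suc n) * g 0 + (f ⊛ tail g) n
    ⊛-suc f g zero    = swap (f 0 * g 1) (f 1 * g 0) 0#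
    ⊛-suc f g (suc n) = begin
      f 0 * g (2 ℕ.+ n) + (tail f ⊛ g) (suc n)
        ≈⟨ R.+-congˡ (⊛-suc (tail f) g n) ⟩
      f 0 * g (2 ℕ.+ n) + (f (2 ℕ.+ n) * g 0 + (tail f ⊛ tail g) n)
        ≈⟨ swap _ _ _ ⟩
      f (2 ℕ.+ n) * g 0 + (f ⊛ tail g) (suc n) ∎

    ⊛-comm : ∀ f g n → (f ⊛ g) n ≈ (g ⊛ f) n
    ⊛-comm f g zero    = R.+-congʳ (R.*-comm (f 0) (g 0))
    ⊛-comm f g (suc n) = begin
      f 0 * g (suc n) + (tail f ⊛ g) n
        ≈⟨ R.+-cong (R.*-comm (f 0) (g (suc n))) (⊛-comm (tail f) g n) ⟩
      g (suc n) * f 0 + (g ⊛ tail f) n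
        ≈⟨ ⊛-suc g f n ⟨
      (g ⊛ f) (suc n) ∎

    ⊛-distribʳ : ∀ h f g n → ((f ⊕ g) ⊛ h) n ≈ (f ⊛ h) n + (g ⊛ h) n
    ⊛-distribʳ h f g zero    = begin
      (f 0 + g 0) * h 0 + 0#
        ≈⟨ R.+-cong (R.distribʳ (h 0) (f 0) (g 0)) (R.sym (R.+-identityˡ 0#)) ⟩
      (f 0 * h 0 + g 0 * h 0) + (0# + 0#)
        ≈⟨ interchange _ _ _ _ ⟩
      (f 0 * h 0 + 0#) + (g 0 * h 0 + 0#) ∎
    ⊛-distribʳ h f g (suc n) = begin
      (f 0 + g 0) * h (suc n) + ((tail f ⊕ tail g) ⊛ h) n
        ≈⟨ R.+-cong (R.distribʳ (h (suc n)) (f 0) (g 0)) (⊛-distribʳ h (tail f) (tail g) n) ⟩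
      (f 0 * h (suc n) + g 0 * h (suc n)) + ((tail f ⊛ h) n + (tail g ⊛ h) n)
        ≈⟨ interchange _ _ _ _ ⟩
      (f ⊛ h) (suc n) + (g ⊛ h) (suc n) ∎

    ⊛-distribˡ : ∀ h f g n → (h ⊛ (f ⊕ g)) n ≈ (h ⊛ f) n + (h ⊛ g) n
    ⊛-distribˡ h f g n = begin
      (h ⊛ (f ⊕ g)) n         ≈⟨ ⊛-comm h (f ⊕ g) n ⟩
      ((f ⊕ g) ⊛ h) n         ≈⟨ ⊛-distribʳ h f g n ⟩
      (f ⊛ h) n + (g ⊛ h) n   ≈⟨ R.+-cong (⊛-comm f h n) (⊛-comm g h n) ⟩
      (h ⊛ f) n + (h ⊛ g) n   ∎

    ⊛-scale : ∀ a f g n → ((λ k → a * f k) ⊛ g) n ≈ a * (f ⊛ g) n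
    ⊛-scale a f g zero    = begin
      (a * f 0) * g 0 + 0#     ≈⟨ R.+-cong (R.*-assoc a (f 0) (g 0)) (R.sym (R.zeroʳ a)) ⟩
      a * (f 0 * g 0) + a * 0# ≈⟨ R.distribˡ a (f 0 * g 0) 0# ⟨
      a * (f 0 * g 0 + 0#)     ∎
    ⊛-scale a f g (suc n) = begin
      (a * f 0) * g (suc n) + ((λ k → a * f (suc k)) ⊛ g) n
        ≈⟨ R.+-cong (R.*-assoc a (f 0) (g (suc n))) (⊛-scale a (tail f) g n) ⟩
      a * (f 0 * g (suc n)) + a * (tail f ⊛ g) n
        ≈⟨ R.distribˡ a _ _ ⟨
      a * (f ⊛ g) (suc n) ∎

    ⊛-assoc : ∀ f g h n → ((f ⊛ g) ⊛ h) n ≈ (f ⊛ (g ⊛ h)) n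
    ⊛-assoc f g h zero    = R.+-congʳ (begin
      (f 0 * g 0 + 0#) * h 0   ≈⟨ R.*-congʳ (R.+-identityʳ _) ⟩
      (f 0 * g 0) * h 0        ≈⟨ R.*-assoc _ _ _ ⟩
      f 0 * (g 0 * h 0)        ≈⟨ R.*-congˡ (R.+-identityʳ _) ⟨
      f 0 * (g 0 * h 0 + 0#)   ∎)
    ⊛-assoc f g h (suc n) = begin
      (f 0 * g 0 + 0#) * h (suc n) + (((λ k → f 0 * g (suc k)) ⊕ (tail f ⊛ g)) ⊛ h) n
        ≈⟨ R.+-cong (R.*-congʳ (R.+-identityʳ _)) (⊛-distribʳ h (λ k → f 0 * g (suc k)) (tail f ⊛ g) n) ⟩
      (f 0 * g 0) * h (suc n) + (((λ k → f 0 * g (suc k)) ⊛ h) n + ((tail f ⊛ g) ⊛ h) n)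
        ≈⟨ R.+-cong (R.*-assoc _ _ _)
             (R.+-cong (⊛-scale (f 0) (tail g) h n) (⊛-assoc (tail f) g h n)) ⟩
      f 0 * (g 0 * h (suc n)) + (f 0 * (tail g ⊛ h) n + (tail f ⊛ (g ⊛ h)) n)
        ≈⟨ R.+-assoc _ _ _ ⟨
      (f 0 * (g 0 * h (suc n)) + f 0 * (tail g ⊛ h) n) + (tail f ⊛ (g ⊛ h)) n
        ≈⟨ R.+-congʳ (R.distribˡ (f 0) _ _) ⟨
      f 0 * (g ⊛ h) (suc n) + (tail f ⊛ (g ⊛ h)) n ∎

    ⊛-zeroˡ : ∀ f n → ((λ _ → 0#) ⊛ f) n ≈ 0#
    ⊛-zeroˡ f zero    = R.trans (R.+-identityʳ _) (R.zeroˡ (f 0))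
    ⊛-zeroˡ f (suc n) =
      R.trans (R.+-cong (R.zeroˡ (f (suc n))) (⊛-zeroˡ f n)) (R.+-identityʳ 0#)

    ⊛-identityˡ : ∀ f n → (const 1# ⊛ f) n ≈ f n
    ⊛-identityˡ f zero    = R.trans (R.+-identityʳ _) (R.*-identityˡ (f 0))
    ⊛-identityˡ f (suc n) = begin
      1# * f (suc n) + (tail (const 1#) ⊛ f) n
        ≈⟨ R.+-cong (R.*-identityˡ (f (suc n))) (⊛-zeroˡ f n) ⟩
      f (suc n) + 0#
        ≈⟨ R.+-identityʳ _ ⟩
      f (suc n) ∎

    ≋-isEquivalence : IsEquivalence _≋_
    ≋-isEquivalence = record
      { refl  = coeffwise λ _ → R.refl
      ; sym   = λ p → coeffwise λ n → R.sym (coeff-≈ p n)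
      ; trans = λ p q → coeffwise λ n → R.trans (coeff-≈ p n) (coeff-≈ q n)
      }

  seriesRing : CommutativeRing c ℓ
  seriesRing = record
    { Carrier = Series
    ; _≈_ = _≋_
    ; _+_ = _⊕_
    ; _*_ = _⊛_
    ; -_  = ⊝_
    ; 0#  = λ _ → 0#
    ; 1#  = const 1#
    ; isCommutativeRing = record
      { isRing = record
        { +-isAbelianGroup = record
          { isGroup = record
            { isMonoid = record
              { isSemigroup = record
                { isMagma = record
                  { isEquivalence = ≋-isEquivalence
                  ; ∙-cong = λ p q → coeffwise λ n → R.+-cong (coeff-≈ p n) (coeff-≈ q n)
                  }
                ; assoc = λ f g h → coeffwise λ n → R.+-assoc (f n) (g n) (h n)
                }
              ; identity = (λ f → coeffwise λ n → R.+-identityˡ (f n))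
                         , (λ f → coeffwise λ n → R.+-identityʳ (f n))
              }
            ; inverse = (λ f → coeffwise λ n → R.-‿inverseˡ (f n))
                      , (λ f → coeffwise λ n → R.-‿inverseʳ (f n))
            ; ⁻¹-cong = λ p → coeffwise λ n → R.-‿cong (coeff-≈ p n)
            }
          ; comm = λ f g → coeffwise λ n → R.+-comm (f n) (g n)
          }
        ; *-cong = ⊛-cong
        ; *-assoc = λ f g h → coeffwise (⊛-assoc f g h)
        ; *-identity = (λ f → coeffwise (⊛-identityˡ f))
                     , (λ f → coeffwise λ n →
                          R.trans (⊛-comm f (const 1#) n) (⊛-identityˡ f n))
        ; distrib = (λ h f g → coeffwise (⊛-distribˡ h f g))
                  , (λ h f g → coeffwise (⊛-distribʳ h f g))
        }
      ; *-comm = λ f g → coeffwise (⊛-comm f g)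
      }
    }

  private
    module S = CommutativeRing seriesRing
    module SP = RingProperties S.ring
    module SSum = Sum S.semiring
  open Exp S.semiring using (_^_)

  private
    geometric : Series → ℕ → Series
    geometric h n = SSum.sum {suc n} (λ k → h ^ toℕ k)

  -- Meaningful only for f with constant term 1: then (1 - f)ᵏ has no terms of
  -- degree below k, so the coefficient of zⁿ in 1/f = ∑ₖ (1 - f)ᵏ only
  -- receives contributions from k ≤ n.
  infix 8 _⁻¹
  _⁻¹ : Series → Series
  (f ⁻¹) n = SSum.sum {suc n} (λ k → (S.1# S.- f) ^ toℕ k) n

  infixl 7 _/_
  _/_ : Series → Series → Series
  f / g = f ⊛ g ⁻¹

  private
    geometric-suc : ∀ h n → geometric h (suc n) ≋ S.1# ⊕ h ⊛ geometric h n
    geometric-suc h n = S.+-congˡ (S.sym (SSum.*-distribˡ-sum {suc n} h (λ k → h ^ toℕ k)))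

    ⊛-agree : ∀ h f g n → h 0 ≈ 0# → (∀ j → j < n → f j ≈ g j) →
              (h ⊛ f) n ≈ (h ⊛ g) n
    ⊛-agree h f g zero h₀ _ = R.+-congʳ (begin
      h 0 * f 0 ≈⟨ R.*-congʳ h₀ ⟩
      0# * f 0  ≈⟨ R.zeroˡ (f 0) ⟩
      0#        ≈⟨ R.zeroˡ (g 0) ⟨
      0# * g 0  ≈⟨ R.*-congʳ h₀ ⟨
      h 0 * g 0 ∎)
    ⊛-agree h f g (suc n) h₀ eq = R.+-cong
      (begin
        h 0 * f (suc n) ≈⟨ R.*-congʳ h₀ ⟩
        0# * f (suc n)  ≈⟨ R.zeroˡ _ ⟩
        0#              ≈⟨ R.zeroˡ _ ⟨
        0# * g (suc n)  ≈⟨ R.*-congʳ h₀ ⟨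
        h 0 * g (suc n) ∎)
      (⊛-cong-at (tail h) (tail h) f g n (λ _ → R.refl) λ j j≤n → eq j (s≤s j≤n))

    geometric-at-0 : ∀ {h} → h 0 ≈ 0# → ∀ n → geometric h (suc n) 0 ≈ geometric h 0 0
    geometric-at-0 {h} h₀ n = begin
      geometric h (suc n) 0      ≈⟨ coeff-≈ (geometric-suc h n) 0 ⟩
      1# + (h ⊛ geometric h n) 0 ≈⟨ R.+-congˡ (⊛-agree h (geometric h n) (λ _ → 0#) 0 h₀ λ _ ()) ⟩
      1# + (h ⊛ (λ _ → 0#)) 0    ≈⟨ R.+-congˡ (coeff-≈ (S.zeroʳ h) 0) ⟩
      1# + 0#                    ∎

    geometric-stable : ∀ {h} → h 0 ≈ 0# → ∀ n m j → j ≤ n → j ≤ m →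
                       geometric h n j ≈ geometric h m j
    geometric-stable h₀ zero zero j _ _ = R.refl
    geometric-stable {h} h₀ zero (suc m) zero _ _ = R.sym (geometric-at-0 {h} h₀ m)
    geometric-stable {h} h₀ (suc n) zero zero _ _ = geometric-at-0 {h} h₀ n
    geometric-stable {h} h₀ (suc n) (suc m) j j≤n j≤m = begin
      geometric h (suc n) j                 ≈⟨ coeff-≈ (geometric-suc h n) j ⟩
      S.1# j + (h ⊛ geometric h n) j        ≈⟨ R.+-congˡ (⊛-agree h (geometric h n) (geometric h m) j h₀ λ i i<j →
                                                geometric-stable {h} h₀ n m i
                                                  (ℕₚ.≤-pred (ℕₚ.<-≤-trans i<j j≤n))
                                                  (ℕₚ.≤-pred (ℕₚ.<-≤-trans i<j j≤m))) ⟩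
      S.1# j + (h ⊛ geometric h m) j        ≈⟨ coeff-≈ (geometric-suc h m) j ⟨
      geometric h (suc m) j                 ∎

  ⁻¹-inverseʳ : ∀ f → f 0 ≈ 1# → f ⊛ f ⁻¹ ≋ S.1#
  ⁻¹-inverseʳ f f₀ = inverse
    where
    module SR = ≈-Reasoning S.setoid

    h : Series
    h = S.1# S.- f

    h₀ : h 0 ≈ 0#
    h₀ = R.trans (R.+-congˡ (R.-‿cong f₀)) (R.-‿inverseʳ 1#)

    fixpoint : f ⁻¹ ≋ S.1# ⊕ h ⊛ f ⁻¹
    fixpoint = coeffwise λ n → begin
      geometric h n n                 ≈⟨ geometric-stable {h} h₀ n (suc n) n ℕₚ.≤-refl (ℕₚ.n≤1+n n) ⟩
      geometric h (suc n) n           ≈⟨ coeff-≈ (geometric-suc h n) n ⟩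
      S.1# n + (h ⊛ geometric h n) n  ≈⟨ R.+-congˡ (⊛-agree h (geometric h n) (f ⁻¹) n h₀ λ j j<n →
                                           geometric-stable {h} h₀ n j j (ℕₚ.<⇒≤ j<n) ℕₚ.≤-refl) ⟩
      S.1# n + (h ⊛ f ⁻¹) n           ∎

    f≋1-h : f ≋ S.1# S.- h
    f≋1-h = S.sym (SR.begin
      S.1# ⊕ ⊝ (S.1# ⊕ ⊝ f)        SR.≈⟨ S.+-congˡ (SP.-‿+-comm S.1# (⊝ f)) ⟨
      S.1# ⊕ (⊝ S.1# ⊕ ⊝ (⊝ f))    SR.≈⟨ S.+-assoc _ _ _ ⟨
      (S.1# ⊕ ⊝ S.1#) ⊕ ⊝ (⊝ f)    SR.≈⟨ S.+-cong (S.-‿inverseʳ S.1#) (SP.-‿involutive f) ⟩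
      S.0# ⊕ f                     SR.≈⟨ S.+-identityˡ f ⟩
      f                            SR.∎)

    inverse : f ⊛ f ⁻¹ ≋ S.1#
    inverse = SR.begin
      f ⊛ f ⁻¹                                SR.≈⟨ S.*-congʳ f≋1-h ⟩
      (S.1# S.- h) ⊛ f ⁻¹                     SR.≈⟨ S.distribʳ (f ⁻¹) S.1# (⊝ h) ⟩
      S.1# ⊛ f ⁻¹ ⊕ ⊝ h ⊛ f ⁻¹                SR.≈⟨ S.+-cong (S.*-identityˡ (f ⁻¹)) (S.sym (SP.-‿distribˡ-* h (f ⁻¹))) ⟩
      f ⁻¹ ⊕ ⊝ (h ⊛ f ⁻¹)                     SR.≈⟨ S.+-congʳ fixpoint ⟩
      (S.1# ⊕ h ⊛ f ⁻¹) ⊕ ⊝ (h ⊛ f ⁻¹)        SR.≈⟨ S.+-assoc _ _ _ ⟩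
      S.1# ⊕ (h ⊛ f ⁻¹ ⊕ ⊝ (h ⊛ f ⁻¹))        SR.≈⟨ S.+-congˡ (S.-‿inverseʳ _) ⟩
      S.1# ⊕ S.0#                             SR.≈⟨ S.+-identityʳ _ ⟩
      S.1#                                    SR.∎

module Polynomial (R : CommutativeRing c ℓ) where

  private
    module R = CommutativeRing R
    module RP = RingProperties R.ring
    module Ser = PowerSeries R
    module Σ = CommutativeRing Ser.seriesRing
  open R using (_≈_; _+_; _*_; -_; 0#; 1#)

  -- Coefficients in order of increasing degree; trailing zeros are allowed,
  -- and are ignored by _≈ₚ_.
  Poly : Set c
  Poly = List R.Carrier

  coeff : Poly → ℕ → R.Carrier
  coeff []      _       = 0#
  coeff (a ∷ _) zero    = a
  coeff (_ ∷ p) (suc i) = coeff p i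

  infix 4 _≈ₚ_
  record _≈ₚ_ (p q : Poly) : Set ℓ where
    constructor coeffwise
    field coeff-≈ : ∀ i → coeff p i ≈ coeff q i
  open _≈ₚ_ public

  infixl 6 _+ₚ_
  infixl 7 _*ₚ_

  _+ₚ_ : Poly → Poly → Poly
  []      +ₚ q       = q
  (a ∷ p) +ₚ []      = a ∷ p
  (a ∷ p) +ₚ (b ∷ q) = (a + b) ∷ (p +ₚ q)

  -ₚ_ : Poly → Poly
  -ₚ p = map -_ p

  _*ₚ_ : Poly → Poly → Poly
  []      *ₚ q = []
  (a ∷ p) *ₚ q = map (a *_) q +ₚ (0# ∷ p *ₚ q)

  constant : R.Carrier → Poly
  constant a = a ∷ []

  X : Poly
  X = 0# ∷ 1# ∷ []

  private
    open ≈-Reasoning R.setoid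

    coeff-+ : ∀ p q i → coeff (p +ₚ q) i ≈ coeff p i + coeff q i
    coeff-+ []      q       i       = R.sym (R.+-identityˡ _)
    coeff-+ (a ∷ p) []      i       = R.sym (R.+-identityʳ _)
    coeff-+ (a ∷ p) (b ∷ q) zero    = R.refl
    coeff-+ (a ∷ p) (b ∷ q) (suc i) = coeff-+ p q i

    coeff-neg : ∀ p i → coeff (-ₚ p) i ≈ - coeff p i
    coeff-neg []      i       = R.sym RP.-0#≈0#
    coeff-neg (a ∷ p) zero    = R.refl
    coeff-neg (a ∷ p) (suc i) = coeff-neg p i

    coeff-scale : ∀ a p i → coeff (map (a *_) p) i ≈ a * coeff p i
    coeff-scale a []      i       = R.sym (R.zeroʳ a)
    coeff-scale a (b ∷ p) zero    = R.refl
    coeff-scale a (b ∷ p) (suc i) = coeff-scale a p i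

    coeff-* : ∀ p q i → coeff (p *ₚ q) i ≈ (coeff p Σ.* coeff q) i
    coeff-* [] q i = R.sym (Ser.coeff-≈ (Σ.zeroˡ (coeff q)) i)
    coeff-* (a ∷ p) q zero = begin
      coeff (map (a *_) q +ₚ (0# ∷ p *ₚ q)) 0 ≈⟨ coeff-+ (map (a *_) q) _ 0 ⟩
      coeff (map (a *_) q) 0 + 0#             ≈⟨ R.+-congʳ (coeff-scale a q 0) ⟩
      a * coeff q 0 + 0#                      ∎
    coeff-* (a ∷ p) q (suc i) = begin
      coeff (map (a *_) q +ₚ (0# ∷ p *ₚ q)) (suc i)
        ≈⟨ coeff-+ (map (a *_) q) _ (suc i) ⟩
      coeff (map (a *_) q) (suc i) + coeff (p *ₚ q) i
        ≈⟨ R.+-cong (coeff-scale a q (suc i)) (coeff-* p q i) ⟩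
      a * coeff q (suc i) + (coeff p Σ.* coeff q) i ∎

    coeff-1 : ∀ i → coeff (constant 1#) i ≈ Σ.1# i
    coeff-1 zero    = R.refl
    coeff-1 (suc i) = R.refl

    rawPolyRing : RawRing c ℓ
    rawPolyRing = record
      { Carrier = Poly
      ; _≈_ = _≈ₚ_
      ; _+_ = _+ₚ_
      ; _*_ = _*ₚ_
      ; -_  = -ₚ_
      ; 0#  = []
      ; 1#  = constant 1#
      }

    open RingMorphisms rawPolyRing Σ.rawRing using (IsRingMonomorphism)

    coeff-isRingMonomorphism : IsRingMonomorphism coeff
    coeff-isRingMonomorphism = record
      { isRingHomomorphism = record
        { isSemiringHomomorphism = record
          { isNearSemiringHomomorphism = record
            { +-isMonoidHomomorphism = record
              { isMagmaHomomorphism = record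
                { isRelHomomorphism = record
                  { cong = λ p → Ser.coeffwise (coeff-≈ p) }
                ; homo = λ p q → Ser.coeffwise (coeff-+ p q)
                }
              ; ε-homo = Ser.coeffwise λ _ → R.refl
              }
            ; *-homo = λ p q → Ser.coeffwise (coeff-* p q)
            }
          ; 1#-homo = Ser.coeffwise coeff-1
          }
        ; -‿homo = λ p → Ser.coeffwise (coeff-neg p)
        }
      ; injective = λ p → coeffwise (Ser.coeff-≈ p)
      }

  polyRing : CommutativeRing c ℓ
  polyRing = record
    { RawRing rawPolyRing
    ; isCommutativeRing =
        RingMonomorphism.isCommutativeRing coeff-isRingMonomorphism Σ.isCommutativeRing
    }

  -- The value at x of the polynomial whose coefficients are mapped into S by φ.
  evaluate : (S : CommutativeRing c′ ℓ′) → (R.Carrier → CommutativeRing.Carrier S) →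
             CommutativeRing.Carrier S → Poly → CommutativeRing.Carrier S
  evaluate S φ x = foldr (λ a v → φ a S.+ x S.* v) S.0#
    where module S = CommutativeRing S

-- The list 1, 2, …, n.
[1⋯_] : ℕ → List ℕ
[1⋯ n ] = map suc (upTo n)

words : List ℕ → ℕ → List (List ℕ)
words as zero    = [] ∷ []
words as (suc k) = cartesianProductWith _∷_ as (words as k)

-- The i-th entry of the nondecreasing rearrangement is at most i.
IsParking : ℕ → List ℕ → Set
IsParking n w = Pointwise _≤_ (sort w) [1⋯ n ]

isParking? : ∀ n → Decidable (IsParking n)
isParking? n w = Pointwise.decidable ℕₚ._≤?_ (sort w) [1⋯ n ]

-- Each parking function of length n occurs exactly once.
PF : ℕ → List (List ℕ)
PF n = filter (isParking? n) (words [1⋯ n ] n)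

indicator : {P : Set} → Dec P → ℕ
indicator P? = if does P? then 1 else 0

tie : List ℕ → ℕ
tie (x ∷ w@(y ∷ _)) = indicator (x ℕₚ.≟ y) ℕ.+ tie w
tie _               = 0

pk : List ℕ → ℕ
pk (x ∷ w@(y ∷ v ∷ _)) = indicator ((x ℕₚ.<? y) ×-dec (v ℕₚ.<? y)) ℕ.+ pk w
pk _                   = 0

-- Real coefficients are the case R = ℝ; the library has no reals.
module Insertion (R : CommutativeRing c ℓ) where

  private
    module R[t]   = Polynomial R
    module R[t,u] = Polynomial R[t].polyRing

  -- R[t,u] is encoded as (R[t])[u].
  R[t,u]-ring : CommutativeRing c ℓ
  R[t,u]-ring = R[t,u].polyRing

  open CommutativeRing R[t,u]-ring public
    using (Carrier; _≈_; _+_; _*_; _-_; 0#; 1#)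
  open Exp (CommutativeRing.semiring R[t,u]-ring) public using (_^_)

  scalar : CommutativeRing.Carrier R → Carrier
  scalar a = R[t,u].constant (R[t].constant a)

  t u : Carrier
  t = R[t,u].constant R[t].X
  u = R[t,u].X

  ∑ : {A : Set} → List A → (A → Carrier) → Carrier
  ∑ xs f = foldr (λ x s → f x + s) 0# xs

  syntax ∑ xs (λ x → e) = ∑[ x ∈ xs ] e

  H : ℕ → ℕ → Carrier
  H n m = ∑[ w ∈ filter (λ w → max 0 w ℕₚ.≤? m) (PF n) ] (t ^ pk w * u ^ tie w)

  module Series where

    open PowerSeries R[t,u]-ring public
      using (const; z; _/_; _⁻¹) renaming (seriesRing to R[t,u]⟦z⟧)
    open CommutativeRing R[t,u]⟦z⟧ public
      using () renaming
      (Carrier to Carrierᶻ; _≈_ to _≈ᶻ_; _+_ to _+ᶻ_; _*_ to _*ᶻ_; _-_ to _-ᶻ_; 1# to 1ᶻ)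
    open Exp (CommutativeRing.semiring R[t,u]⟦z⟧) public
      using () renaming (_^_ to _^ᶻ_)

    𝓔 𝓐 𝓑 𝓒 : Carrierᶻ
    𝓔 = 1ᶻ +ᶻ z / (1ᶻ -ᶻ const u *ᶻ z)
    𝓐 = 1ᶻ +ᶻ const t *ᶻ z +ᶻ const u *ᶻ z ^ᶻ 2 / (1ᶻ -ᶻ const u *ᶻ z)
    𝓒 = const u +ᶻ const t *ᶻ z +ᶻ const u *ᶻ z ^ᶻ 2 / (1ᶻ -ᶻ const u *ᶻ z)
    𝓑 = 𝓐 ^ᶻ 2 +ᶻ const t -ᶻ 1ᶻ

    -- F(x, y), with x substituted for t and y for u.
    substitute : Carrier → Carrierᶻ → Carrierᶻ → Carrierᶻ
    substitute F x y =
      R[t,u].evaluate R[t,u]⟦z⟧ (R[t].evaluate R[t,u]⟦z⟧ (λ a → const (scalar a)) x) y F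

    infix 9 [z^_]_
    [z^_]_ : ℕ → Carrierᶻ → Carrier
    [z^ r ] f = f r

  open Series

  -- Only meaningful for ℓ ≥ 1, because of the truncated subtraction.
  𝓘 : ℕ → ℕ → Carrier → Carrier
  𝓘 ℓ r F = [z^ r ] (𝓔 ^ᶻ 2 *ᶻ 𝓐 ^ᶻ (ℓ ∸ 1) *ᶻ substitute F (𝓑 / 𝓐 ^ᶻ 2) (𝓒 / 𝓐))

{-# OPTIONS --safe #-}

-- Deleting the r letters m from a parking function of length n with maximum m leaves
-- a parking function v of length n - r with letters below m; conversely, inserting r ≥ 1
-- letters m into such a v gives a parking function iff m ≤ n - r + 1. It remains to
-- enumerate the insertions into a fixed v of length l. The maximal letter is a peak
-- exactly when it stands alone in an interior gap of v, so each of the two end gaps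
-- contributes 𝓔, an interior gap contributes 𝓐, or 𝓒 if it separates two equal letters,
-- and the two gaps around a peak of v contribute 𝓐² + t - 1 = 𝓑 together, the peak
-- surviving only if both stay empty. Gaps of different peaks are disjoint, so the total
-- is 𝓔² 𝓐ˡ⁻¹ (𝓑/𝓐²)^pk(v) (𝓒/𝓐)^tie(v).

module Submission where

open import Defs
open import Algebra.Bundles using (CommutativeRing)
import Algebra.Properties.CommutativeSemigroup as CommutativeSemigroupProperties
import Algebra.Properties.Group as GroupProperties
import Algebra.Properties.Ring as RingProperties
import Algebra.Properties.Semiring.Exp as Exp
import Algebra.Solver.Ring.NaturalCoefficients.Default as SemiringSolver
open import Data.Bool.Base using (Bool; true; false; _∧_; if_then_else_)
open import Data.Bool.Properties using (∧-zeroʳ)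
open import Data.List.Base
  using (List; []; _∷_; [_]; _++_; _∷ʳ_; cartesianProductWith; filter; foldr; length; map; replicate; upTo)
open import Data.List.Extrema.Nat using (max; max≤v⁺; xs≤max)
open import Data.List.Membership.Propositional using (_∈_)
open import Data.List.Membership.Propositional.Properties using (∈-map⁻; ∈-upTo⁻)
open import Data.List.Properties using (length-map; length-upTo; map-++; map-upTo; upTo-∷ʳ)
open import Data.List.Relation.Binary.Permutation.Propositional
  using (_↭_; prep; ↭-refl; ↭-sym; ↭-trans; ↭⇒↭ₛ)
open import Data.List.Relation.Binary.Permutation.Propositional.Properties
  using (All-resp-↭; shift; ++⁺ʳ; ∷↭∷ʳ; ↭-empty-inv; ↭-length)
open import Data.List.Relation.Binary.Pointwise as Pointwise using (Pointwise; []; _∷_)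
open import Data.List.Relation.Unary.All as All using (All; []; _∷_)
import Data.List.Relation.Unary.All.Properties as All
import Data.List.Relation.Unary.AllPairs as AllPairs
import Data.List.Relation.Unary.AllPairs.Properties as AllPairs
open import Data.List.Relation.Unary.Any using (here; there)
import Data.List.Relation.Unary.Sorted.TotalOrder.Properties as Sorted
open import Data.Nat.Base as ℕ
  using (ℕ; zero; suc; _≤_; _<_; _∸_; _≤′_; z≤n; s≤s; ≤′-refl; ≤′-step) renaming (_+_ to _+ℕ_)
import Data.Nat.Properties as ℕ
open import Data.List.Relation.Unary.Sorted.TotalOrder ℕ.≤-totalOrder using (Sorted)
open import Data.List.Sort ℕ.≤-decTotalOrder using (sort; sort-↭; sort-↗)
open import Data.Product.Base using (_×_; _,_; proj₁; proj₂)
open import Function.Base using (_∘_)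
open import Function.Bundles using (_⇔_; mk⇔; module Equivalence)
open import Level using (_⊔_)
open import Relation.Binary.Core using (REL)
open import Relation.Binary.Definitions using (tri<; tri≈; tri>)
open import Relation.Binary.PropositionalEquality as ≡ using (_≡_; _≢_; refl)
import Relation.Binary.Reasoning.Setoid as SetoidReasoning
open import Relation.Nullary.Decidable using (Dec; does; yes; no; dec-true; dec-false; does-⇔)
open import Relation.Nullary.Negation using (¬_)
open import Relation.Unary using (Pred; Decidable)

-- Parking functions and insertion of a maximal letter

sorted-unique : ∀ {xs ys} → Sorted xs → Sorted ys → xs ↭ ys → xs ≡ ys
sorted-unique xs↗ ys↗ xs↭ys =
  Pointwise.Pointwise-≡⇒≡ (Sorted.↗↭↗⇒≋ ℕ.≤-totalOrder xs↗ ys↗ (↭⇒↭ₛ xs↭ys))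

sort-resp-↭ : ∀ {xs ys} → xs ↭ ys → sort xs ≡ sort ys
sort-resp-↭ {xs} {ys} xs↭ys = sorted-unique (sort-↗ xs) (sort-↗ ys)
  (↭-trans (sort-↭ xs) (↭-trans xs↭ys (↭-sym (sort-↭ ys))))

-- Appending `m` keeps the list sorted because no entry exceeds it, and a sorted rearrangement is
-- unique.
sort-∷-max : ∀ {m w} → All (_≤ m) w → sort (m ∷ w) ≡ sort w ∷ʳ m
sort-∷-max {m} {w} w≤m = sorted-unique (sort-↗ (m ∷ w)) sorted
  (↭-trans (sort-↭ (m ∷ w)) (↭-trans (∷↭∷ʳ m w) (++⁺ʳ [ m ] (↭-sym (sort-↭ w)))))
  where
  sorted : Sorted (sort w ∷ʳ m)
  sorted = Sorted.AllPairs⇒Sorted ℕ.≤-totalOrder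
    (AllPairs.++⁺ (Sorted.Sorted⇒AllPairs ℕ.≤-totalOrder (sort-↗ w)) ([] AllPairs.∷ AllPairs.[])
      (All.map (_∷ []) (All-resp-↭ (↭-sym (sort-↭ w)) w≤m)))

[1⋯suc]-∷ʳ : ∀ n → [1⋯ suc n ] ≡ [1⋯ n ] ∷ʳ suc n
[1⋯suc]-∷ʳ n = ≡.trans (≡.cong (map suc) (≡.sym (upTo-∷ʳ n))) (map-++ suc (upTo n) [ n ])

length-[1⋯] : ∀ n → length [1⋯ n ] ≡ n
length-[1⋯] n = ≡.trans (length-map suc (upTo n)) (length-upTo n)

∷ʳ⁻ : ∀ {a b r} {A : Set a} {B : Set b} {R : REL A B r} {x y} xs ys → length xs ≡ length ys →
      Pointwise R (xs ∷ʳ x) (ys ∷ʳ y) → Pointwise R xs ys × R x y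
∷ʳ⁻ []       []       _  (r ∷ []) = [] , r
∷ʳ⁻ (x ∷ xs) (y ∷ ys) eq (r ∷ rs) with ∷ʳ⁻ xs ys (ℕ.suc-injective eq) rs
... | rs′ , r′ = r ∷ rs′ , r′

-- Reading the length off the word lets the property follow a word through rearrangements and
-- insertions.
Parking : List ℕ → Set
Parking w = IsParking (length w) w

parking-resp-↭ : ∀ {v w} → v ↭ w → Parking v → Parking w
parking-resp-↭ v↭w = ≡.subst₂ IsParking′ (↭-length v↭w) (sort-resp-↭ v↭w)
  where
  IsParking′ : ℕ → List ℕ → Set
  IsParking′ n xs = Pointwise _≤_ xs [1⋯ n ]

-- Sorting puts `m` last, so the entrywise comparison splits into the one for `w` and the single
-- bound at the last position.
parking-∷-max : ∀ {m w} → All (_≤ m) w → Parking (m ∷ w) ⇔ (Parking w × m ≤ suc (length w))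
parking-∷-max {m} {w} w≤m = mk⇔
  (λ p → ∷ʳ⁻ (sort w) [1⋯ n ] (≡.trans (↭-length (sort-↭ w)) (≡.sym (length-[1⋯] n)))
           (≡.subst₂ (Pointwise _≤_) (sort-∷-max w≤m) ([1⋯suc]-∷ʳ n) p))
  (λ (p , m≤) → ≡.subst₂ (Pointwise _≤_) (≡.sym (sort-∷-max w≤m)) (≡.sym ([1⋯suc]-∷ʳ n))
                  (Pointwise.++⁺ p (m≤ ∷ [])))
  where n = length w

-- The letters are added one by one. The bound on `m` is tightest for the first of them, since the
-- word only gets longer; hence the condition does not depend on `r`.
parking-insert-max : ∀ {m v} r → All (_≤ m) v →
                     Parking (replicate (suc r) m ++ v) ⇔ (Parking v × m ≤ suc (length v))
parking-insert-max zero    v≤m = parking-∷-max v≤m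
parking-insert-max {m} {v} (suc r) v≤m = mk⇔
  (λ p → IH.to (proj₁ (S.to p)))
  (λ (p , m≤) → S.from (IH.from (p , m≤) , ℕ.≤-trans m≤ (suc-length r)))
  where
  module IH = Equivalence (parking-insert-max r v≤m)
  module S  = Equivalence (parking-∷-max {m} {replicate (suc r) m ++ v}
    (All.++⁺ (All.replicate⁺ (suc r) ℕ.≤-refl) v≤m))

  suc-length : ∀ r → suc (length v) ≤ suc (length (replicate (suc r) m ++ v))
  suc-length zero    = ℕ.n≤1+n _
  suc-length (suc r) = ℕ.≤-trans (suc-length r) (ℕ.n≤1+n _)

-- Peaks and ties at the start of a word

tie-≡ : ∀ x w → tie (x ∷ x ∷ w) ≡ suc (tie (x ∷ w))
tie-≡ x w rewrite dec-true (x ℕ.≟ x) refl = refl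

tie-≢ : ∀ {x y} w → x ≢ y → tie (x ∷ y ∷ w) ≡ tie (y ∷ w)
tie-≢ {x} {y} w x≢y rewrite dec-false (x ℕ.≟ y) x≢y = refl

pk-≮ : ∀ {x y} w → ¬ x < y → pk (x ∷ y ∷ w) ≡ pk (y ∷ w)
pk-≮ []      x≮y = refl
pk-≮ {x} {y} (v ∷ w) x≮y rewrite dec-false (x ℕ.<? y) x≮y = refl

pk-≯ : ∀ {x y v} w → ¬ v < y → pk (x ∷ y ∷ v ∷ w) ≡ pk (y ∷ v ∷ w)
pk-≯ {x} {y} {v} w v≮y
  rewrite dec-false (v ℕ.<? y) v≮y | ∧-zeroʳ (does (x ℕ.<? y)) = refl

-- The letter `v` right after a peak is reached by a descent and cannot be a peak itself, so
-- counting resumes at `v`.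
pk-peak : ∀ {x y v} w → x < y → v < y → pk (x ∷ y ∷ v ∷ w) ≡ suc (pk (v ∷ w))
pk-peak {x} {y} {v} w x<y v<y
  rewrite dec-true (x ℕ.<? y) x<y | dec-true (v ℕ.<? y) v<y = ≡.cong suc (pk-≮ w (ℕ.<⇒≯ v<y))

-- Letters from an initial segment and constant words

parking? : ∀ w → Dec (Parking w)
parking? w = isParking? (length w) w

∈-[1⋯]⇒≤ : ∀ {a n} → a ∈ [1⋯ n ] → a ≤ n
∈-[1⋯]⇒≤ {n = n} a∈ with ∈-map⁻ suc a∈
... | _ , i∈ , refl = ∈-upTo⁻ i∈

parking-[] : Parking []
parking-[] rewrite ↭-empty-inv (sort-↭ []) = []

parking-replicate-1 : ∀ n → Parking (replicate n 1)
parking-replicate-1 zero    = parking-[]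
parking-replicate-1 (suc n) = Equivalence.from (parking-∷-max (All.replicate⁺ n ℕ.≤-refl))
  (parking-replicate-1 n , s≤s z≤n)

pk-replicate : ∀ n a → pk (replicate n a) ≡ 0
pk-replicate zero          a = refl
pk-replicate (suc zero)    a = refl
pk-replicate (suc (suc n)) a = ≡.trans (pk-≮ (replicate n a) (ℕ.<-irrefl refl)) (pk-replicate (suc n) a)

tie-replicate : ∀ n a → tie (replicate n a) ≡ n ∸ 1
tie-replicate zero          a = refl
tie-replicate (suc zero)    a = refl
tie-replicate (suc (suc n)) a = ≡.trans (tie-≡ a (replicate n a)) (≡.cong suc (tie-replicate (suc n) a))

-- Finite sums over words and over insertions

module Sums {c ℓ} (K : CommutativeRing c ℓ) where

  open CommutativeRing K hiding (refl)
  private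
    module K = CommutativeRing K
    module Solver = SemiringSolver commutativeSemiring
  open CommutativeSemigroupProperties +-commutativeSemigroup using (interchange)
  open SetoidReasoning setoid

  private
    variable
      A B : Set

  -- At the polynomial ring this unfolds to the same fold as `∑` of `Insertion`, so the two are
  -- interchangeable.
  ∑ : List A → (A → Carrier) → Carrier
  ∑ xs f = foldr (λ x s → f x + s) 0# xs

  syntax ∑ xs (λ x → e) = ∑[ x ∈ xs ] e

  ∑-cong-∈ : ∀ (xs : List A) {f g} → (∀ {x} → x ∈ xs → f x ≈ g x) → ∑ xs f ≈ ∑ xs g
  ∑-cong-∈ []       eq = K.refl
  ∑-cong-∈ (x ∷ xs) eq = +-cong (eq (here refl)) (∑-cong-∈ xs (eq ∘ there))

  ∑-cong : ∀ (xs : List A) {f g} → (∀ x → f x ≈ g x) → ∑ xs f ≈ ∑ xs g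
  ∑-cong xs eq = ∑-cong-∈ xs λ {x} _ → eq x

  ∑-0 : ∀ (xs : List A) {f} → (∀ x → f x ≈ 0#) → ∑ xs f ≈ 0#
  ∑-0 []       eq = K.refl
  ∑-0 (x ∷ xs) eq = trans (+-cong (eq x) (∑-0 xs eq)) (+-identityʳ 0#)

  ∑-+ : ∀ (xs : List A) f g → ∑[ x ∈ xs ] (f x + g x) ≈ ∑ xs f + ∑ xs g
  ∑-+ []       f g = sym (+-identityʳ 0#)
  ∑-+ (x ∷ xs) f g = trans (+-congˡ (∑-+ xs f g)) (interchange _ _ _ _)

  ∑-++ : ∀ (xs ys : List A) f → ∑ (xs ++ ys) f ≈ ∑ xs f + ∑ ys f
  ∑-++ []       ys f = sym (+-identityˡ _)
  ∑-++ (x ∷ xs) ys f = trans (+-congˡ (∑-++ xs ys f)) (sym (+-assoc _ _ _))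

  ∑-map : ∀ (g : A → B) xs f → ∑ (map g xs) f ≡ ∑ xs (f ∘ g)
  ∑-map g []       f = refl
  ∑-map g (x ∷ xs) f = ≡.cong (f (g x) +_) (∑-map g xs f)

  ∑-upTo-suc : ∀ n f → ∑ (upTo (suc n)) f ≡ f 0 + ∑ (upTo n) (f ∘ suc)
  ∑-upTo-suc n f = ≡.cong (f 0 +_)
    (≡.trans (≡.cong (λ xs → ∑ xs f) (≡.sym (map-upTo suc n))) (∑-map suc (upTo n) f))

  infixr 6 _▸_
  -- An Iverson bracket: it replaces filtering the index list.
  _▸_ : {P : Set} → Dec P → Carrier → Carrier
  P? ▸ x = if does P? then x else 0#

  ▸-cong : ∀ {P Q : Set} (P? : Dec P) (Q? : Dec Q) {x y} → P ⇔ Q → x ≈ y → P? ▸ x ≈ Q? ▸ y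
  ▸-cong P? Q? P⇔Q x≈y rewrite does-⇔ P⇔Q P? Q? with does Q?
  ... | true  = x≈y
  ... | false = K.refl

  ▸-no : ∀ {P : Set} (P? : Dec P) x → ¬ P → P? ▸ x ≈ 0#
  ▸-no P? x ¬p rewrite dec-false P? ¬p = K.refl

  ▸-0 : ∀ {P : Set} (P? : Dec P) {x} → x ≈ 0# → P? ▸ x ≈ 0#
  ▸-0 P? x≈0 with does P?
  ... | true  = x≈0
  ... | false = K.refl

  ▸-yes : ∀ {P : Set} (P? : Dec P) x → P → P? ▸ x ≈ x
  ▸-yes P? x p rewrite dec-true P? p = K.refl

  ▸-congˡ : ∀ {P : Set} (P? : Dec P) {x y} → x ≈ y → P? ▸ x ≈ P? ▸ y
  ▸-congˡ P? x≈y with does P?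
  ... | true  = x≈y
  ... | false = K.refl

  ∑-filter : ∀ {P : Pred A _} (P? : Decidable P) xs f → ∑ (filter P? xs) f ≈ ∑[ x ∈ xs ] (P? x ▸ f x)
  ∑-filter P? []       f = K.refl
  ∑-filter P? (x ∷ xs) f with does (P? x)
  ... | true  = +-congˡ (∑-filter P? xs f)
  ... | false = trans (∑-filter P? xs f) (sym (+-identityˡ _))

  ∑-words-suc : ∀ as k f → ∑ (words as (suc k)) f ≈ ∑[ a ∈ as ] ∑[ w ∈ words as k ] f (a ∷ w)
  ∑-words-suc as k f = go as (words as k)
    where
    -- The first letters and the tails vary independently here; in the goal both depend on `as`.
    go : ∀ xs ys → ∑ (cartesianProductWith _∷_ xs ys) f ≈ ∑[ a ∈ xs ] ∑[ w ∈ ys ] f (a ∷ w)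
    go []       ys = K.refl
    go (x ∷ xs) ys = trans (∑-++ (map (x ∷_) ys) _ f)
      (+-cong (reflexive (∑-map (x ∷_) ys f)) (go xs ys))

  ∑-words-cong : ∀ as k {f g} → (∀ w → length w ≡ k → All (_∈ as) w → f w ≈ g w) →
                 ∑ (words as k) f ≈ ∑ (words as k) g
  ∑-words-cong as zero    eq = +-congʳ (eq [] refl [])
  ∑-words-cong as (suc k) {f} {g} eq = begin
    ∑ (words as (suc k)) f                      ≈⟨ ∑-words-suc as k f ⟩
    (∑[ a ∈ as ] ∑[ w ∈ words as k ] f (a ∷ w)) ≈⟨ ∑-cong-∈ as (λ {a} a∈as → ∑-words-cong as k
                                                     λ w l w∈as → eq (a ∷ w) (≡.cong suc l) (a∈as ∷ w∈as)) ⟩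
    (∑[ a ∈ as ] ∑[ w ∈ words as k ] g (a ∷ w)) ≈⟨ ∑-words-suc as k g ⟨
    ∑ (words as (suc k)) g                      ∎

  -- Induction on the first letter: `b` contributes nothing, and after any other letter the
  -- remaining summand still vanishes on words containing `b`.
  ∑-words-∷ʳ-vanish : ∀ as b k f → (∀ w → b ∈ w → f w ≈ 0#) →
                      ∑ (words (as ∷ʳ b) k) f ≈ ∑ (words as k) f
  ∑-words-∷ʳ-vanish as b zero    f f≈0 = K.refl
  ∑-words-∷ʳ-vanish as b (suc k) f f≈0 = begin
    ∑ (words (as ∷ʳ b) (suc k)) f
      ≈⟨ ∑-words-suc (as ∷ʳ b) k f ⟩
    (∑[ a ∈ as ∷ʳ b ] ∑[ w ∈ words (as ∷ʳ b) k ] f (a ∷ w))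
      ≈⟨ ∑-++ as [ b ] _ ⟩
    (∑[ a ∈ as ] ∑[ w ∈ words (as ∷ʳ b) k ] f (a ∷ w)) + ((∑[ w ∈ words (as ∷ʳ b) k ] f (b ∷ w)) + 0#)
      ≈⟨ +-cong (∑-cong as λ a → ∑-words-∷ʳ-vanish as b k (f ∘ (a ∷_)) λ w → f≈0 (a ∷ w) ∘ there)
                (trans (+-identityʳ _) (∑-0 (words (as ∷ʳ b) k) λ w → f≈0 (b ∷ w) (here refl))) ⟩
    (∑[ a ∈ as ] ∑[ w ∈ words as k ] f (a ∷ w)) + 0#
      ≈⟨ +-identityʳ _ ⟩
    (∑[ a ∈ as ] ∑[ w ∈ words as k ] f (a ∷ w))
      ≈⟨ ∑-words-suc as k f ⟨
    ∑ (words as (suc k)) f ∎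

  ∑-words-singleton : ∀ a k f → ∑ (words [ a ] k) f ≈ f (replicate k a)
  ∑-words-singleton a zero    f = +-identityʳ _
  ∑-words-singleton a (suc k) f = trans (∑-words-suc [ a ] k f)
    (trans (+-identityʳ _) (∑-words-singleton a k (f ∘ (a ∷_))))

  -- The sum of f over the words obtained from v by inserting r copies of m; each is
  -- counted once when m does not occur in v.
  ∑-insertions : ℕ → ℕ → List ℕ → (List ℕ → Carrier) → Carrier
  ∑-insertions m zero    v       f = f v
  ∑-insertions m (suc r) []      f = ∑-insertions m r [] (f ∘ (m ∷_))
  ∑-insertions m (suc r) (a ∷ v) f =
    ∑-insertions m r (a ∷ v) (f ∘ (m ∷_)) + ∑-insertions m (suc r) v (f ∘ (a ∷_))

  -- Every word summed over is a rearrangement of `replicate r m ++ v`. This is how a property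
  -- invariant under rearrangement, such as `Parking`, is decided for all insertions at once.
  ∑-insertions-cong : ∀ {m} r v {f g} → (∀ w → w ↭ replicate r m ++ v → f w ≈ g w) →
                      ∑-insertions m r v f ≈ ∑-insertions m r v g
  ∑-insertions-cong zero    v       eq = eq v ↭-refl
  ∑-insertions-cong {m} (suc r) [] eq = ∑-insertions-cong r [] λ w p → eq (m ∷ w) (prep m p)
  ∑-insertions-cong {m} (suc r) (a ∷ v) eq = +-cong
    (∑-insertions-cong r (a ∷ v) λ w p → eq (m ∷ w) (prep m p))
    (∑-insertions-cong (suc r) v λ w p → eq (a ∷ w)
      (↭-trans (prep a p) (↭-sym (shift a (replicate (suc r) m) v))))

  ∑-insertions-0 : ∀ {m} r v {f} → (∀ w → f w ≈ 0#) → ∑-insertions m r v f ≈ 0#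
  ∑-insertions-0 zero    v       eq = eq v
  ∑-insertions-0 {m} (suc r) []  eq = ∑-insertions-0 r [] (eq ∘ (m ∷_))
  ∑-insertions-0 {m} (suc r) (a ∷ v) eq = trans
    (+-cong (∑-insertions-0 r (a ∷ v) (eq ∘ (m ∷_))) (∑-insertions-0 (suc r) v (eq ∘ (a ∷_))))
    (+-identityʳ 0#)

  -- The sum of `F k r` over k + r = n, written with a shift of `F` instead of a subtraction. Below,
  -- `r` counts the copies of the maximal letter and `k` the other letters.
  antidiagonal : (ℕ → ℕ → Carrier) → ℕ → Carrier
  antidiagonal F zero    = F 0 0
  antidiagonal F (suc n) = F (suc n) 0 + antidiagonal (λ k r → F k (suc r)) n

  antidiagonal-∑ : ∀ (xs : List A) (F : A → ℕ → ℕ → Carrier) n →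
    antidiagonal (λ k r → ∑[ x ∈ xs ] F x k r) n ≈ ∑[ x ∈ xs ] antidiagonal (F x) n
  antidiagonal-∑ xs F zero    = K.refl
  antidiagonal-∑ xs F (suc n) =
    trans (+-congˡ (antidiagonal-∑ xs (λ x k r → F x k (suc r)) n)) (sym (∑-+ xs _ _))

  -- g is only there to make the induction go through; it is 0 in the application.
  antidiagonal-suc : ∀ (F G H : ℕ → ℕ → Carrier) (g : ℕ → Carrier) →
    (∀ r → F 0 (suc r) ≈ G 0 r) →
    (∀ k r → F (suc k) (suc r) ≈ G (suc k) r + H k (suc r)) →
    (∀ k → F (suc k) 0 ≈ g k + H k 0) →
    ∀ n → antidiagonal F (suc n) ≈ (g n + antidiagonal G n) + antidiagonal H n
  antidiagonal-suc F G H g F₀ F₊ Fg zero    = begin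
    F 1 0 + F 0 1           ≈⟨ +-cong (Fg 0) (F₀ 0) ⟩
    (g 0 + H 0 0) + G 0 0   ≈⟨ solve 3 (λ a b x → ((a :+ b) :+ x) := ((a :+ x) :+ b)) K.refl _ _ _ ⟩
    (g 0 + G 0 0) + H 0 0   ∎
    where open Solver
  antidiagonal-suc F G H g F₀ F₊ Fg (suc n) = begin
    F (suc (suc n)) 0 + antidiagonal (λ k r → F k (suc r)) (suc n)
      ≈⟨ +-cong (Fg (suc n)) (antidiagonal-suc (λ k r → F k (suc r)) (λ k r → G k (suc r))
           (λ k r → H k (suc r)) (λ k → G (suc k) 0) (F₀ ∘ suc) (λ k → F₊ k ∘ suc) (λ k → F₊ k 0) n) ⟩
    (g (suc n) + H (suc n) 0) + (antidiagonal G (suc n) + antidiagonal (λ k r → H k (suc r)) n)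
      ≈⟨ interchange _ _ _ _ ⟩
    (g (suc n) + antidiagonal G (suc n)) + antidiagonal H (suc n) ∎

  -- Only the terms with k = n - r ≥ j survive, that is those with r < suc n - j. For j > n the
  -- truncated subtraction gives an empty list, and the whole antidiagonal vanishes.
  antidiagonal-truncate : ∀ {F G : ℕ → ℕ → Carrier} j →
    (∀ k r → k < j → F k r ≈ 0#) → (∀ k r → j ≤ k → F k r ≈ G k r) →
    ∀ n → antidiagonal F n ≈ ∑[ r ∈ upTo (suc n ∸ j) ] G (n ∸ r) r
  antidiagonal-truncate {F} {G} j F≈0 F≈G n with j ℕ.≤? n
  antidiagonal-truncate {F} {G} zero F≈0 F≈G zero | yes _ =
    trans (F≈G 0 0 z≤n) (sym (+-identityʳ _))
  antidiagonal-truncate {F} {G} j F≈0 F≈G (suc n) | yes j≤n = begin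
    F (suc n) 0 + antidiagonal (λ k r → F k (suc r)) n
      ≈⟨ +-cong (F≈G (suc n) 0 j≤n) (antidiagonal-truncate j (λ k → F≈0 k ∘ suc) (λ k → F≈G k ∘ suc) n) ⟩
    G (suc n) 0 + (∑[ r ∈ upTo (suc n ∸ j) ] G (n ∸ r) (suc r))
      ≈⟨ reflexive (∑-upTo-suc (suc n ∸ j) (λ r → G (suc n ∸ r) r)) ⟨
    (∑[ r ∈ upTo (suc (suc n ∸ j)) ] G (suc n ∸ r) r)
      ≡⟨ ≡.cong (λ x → ∑[ r ∈ upTo x ] G (suc n ∸ r) r) (≡.sym (ℕ.+-∸-assoc 1 j≤n)) ⟩
    (∑[ r ∈ upTo (suc (suc n) ∸ j) ] G (suc n ∸ r) r) ∎
  ... | no j≰n rewrite ℕ.m≤n⇒m∸n≡0 (ℕ.≰⇒> j≰n) = vanish F n λ k r k≤n → F≈0 k r (ℕ.≤-<-trans k≤n (ℕ.≰⇒> j≰n))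
    where
    vanish : ∀ (F : ℕ → ℕ → Carrier) n → (∀ k r → k ≤ n → F k r ≈ 0#) → antidiagonal F n ≈ 0#
    vanish F zero    F≈0 = F≈0 0 0 z≤n
    vanish F (suc n) F≈0 = trans
      (+-cong (F≈0 (suc n) 0 ℕ.≤-refl)
              (vanish (λ k r → F k (suc r)) n λ k r k≤n → F≈0 k (suc r) (ℕ.m≤n⇒m≤1+n k≤n)))
      (+-identityʳ 0#)

  ∑-insertions-words : List ℕ → ℕ → (List ℕ → Carrier) → ℕ → ℕ → Carrier
  ∑-insertions-words as m f k r = ∑[ v ∈ words as k ] ∑-insertions m r v f

  -- Words are classified by the number of occurrences of the appended letter, and deleting these
  -- leaves a word over `as`. The induction is on the first letter, as in the recursion of
  -- `∑-insertions`.
  ∑-words-∷ʳ : ∀ as m n f → ∑ (words (as ∷ʳ m) n) f ≈ antidiagonal (∑-insertions-words as m f) n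
  ∑-words-∷ʳ as m zero    f = K.refl
  ∑-words-∷ʳ as m (suc n) f = begin
    ∑ (words (as ∷ʳ m) (suc n)) f
      ≈⟨ ∑-words-suc (as ∷ʳ m) n f ⟩
    (∑[ a ∈ as ∷ʳ m ] ∑[ w ∈ words (as ∷ʳ m) n ] f (a ∷ w))
      ≈⟨ ∑-cong (as ∷ʳ m) (λ a → ∑-words-∷ʳ as m n (f ∘ (a ∷_))) ⟩
    (∑[ a ∈ as ∷ʳ m ] antidiagonal (S a) n)
      ≈⟨ ∑-++ as [ m ] _ ⟩
    (∑[ a ∈ as ] antidiagonal (S a) n) + (antidiagonal (S m) n + 0#)
      ≈⟨ +-congʳ (antidiagonal-∑ as S n) ⟨
    antidiagonal (λ k r → ∑[ a ∈ as ] S a k r) n + (antidiagonal (S m) n + 0#)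
      ≈⟨ trans (+-comm _ _) (+-congʳ (+-comm _ _)) ⟩
    (0# + antidiagonal (S m) n) + antidiagonal (λ k r → ∑[ a ∈ as ] S a k r) n
      -- A first letter `m` uses up one copy, a first letter from `as` one letter of the underlying
      -- word. Without copies of `m` only the second case occurs, so `g` is 0.
      ≈⟨ antidiagonal-suc (∑-insertions-words as m f) (S m) (λ k r → ∑[ a ∈ as ] S a k r) (λ _ → 0#)
           (λ r → K.refl) split (λ k → trans (∑-words-suc as k f) (sym (+-identityˡ _))) n ⟨
    antidiagonal (∑-insertions-words as m f) (suc n) ∎
    where
    S : ℕ → ℕ → ℕ → Carrier
    S a = ∑-insertions-words as m (f ∘ (a ∷_))

    split : ∀ k r → ∑-insertions-words as m f (suc k) (suc r) ≈ S m (suc k) r + ∑[ a ∈ as ] S a k (suc r)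
    split k r = begin
      ∑-insertions-words as m f (suc k) (suc r)
        ≈⟨ ∑-words-suc as k _ ⟩
      (∑[ a ∈ as ] ∑[ v ∈ words as k ]
        (∑-insertions m r (a ∷ v) (f ∘ (m ∷_)) + ∑-insertions m (suc r) v (f ∘ (a ∷_))))
        ≈⟨ ∑-cong as (λ a → ∑-+ (words as k) _ _) ⟩
      (∑[ a ∈ as ] ((∑[ v ∈ words as k ] ∑-insertions m r (a ∷ v) (f ∘ (m ∷_))) + S a k (suc r)))
        ≈⟨ ∑-+ as _ _ ⟩
      (∑[ a ∈ as ] ∑[ v ∈ words as k ] ∑-insertions m r (a ∷ v) (f ∘ (m ∷_))) + (∑[ a ∈ as ] S a k (suc r))
        ≈⟨ +-congʳ (∑-words-suc as k _) ⟨
      S m (suc k) r + (∑[ a ∈ as ] S a k (suc r)) ∎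

-- Sums over parking functions

module ParkingSums {c ℓ} (K : CommutativeRing c ℓ) where

  open CommutativeRing K hiding (refl; zero)
  private module K = CommutativeRing K
  open Sums K
  open SetoidReasoning setoid

  ∑-words-restrict : ∀ {m n} k f → m ≤ n → (∀ b w → m < b → b ∈ w → f w ≈ 0#) →
                     ∑ (words [1⋯ n ] k) f ≈ ∑ (words [1⋯ m ] k) f
  ∑-words-restrict {m} k f m≤n f≈0 = go (ℕ.≤⇒≤′ m≤n)
    where
    go : ∀ {n} → m ≤′ n → ∑ (words [1⋯ n ] k) f ≈ ∑ (words [1⋯ m ] k) f
    go ≤′-refl = K.refl
    go {suc n} (≤′-step m≤′n) = begin
      ∑ (words [1⋯ suc n ] k) f
        ≡⟨ ≡.cong (λ as → ∑ (words as k) f) ([1⋯suc]-∷ʳ n) ⟩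
      ∑ (words ([1⋯ n ] ++ [ suc n ]) k) f
        ≈⟨ ∑-words-∷ʳ-vanish [1⋯ n ] (suc n) k f (λ w → f≈0 (suc n) w (s≤s (ℕ.≤′⇒≤ m≤′n))) ⟩
      ∑ (words [1⋯ n ] k) f
        ≈⟨ go m≤′n ⟩
      ∑ (words [1⋯ m ] k) f ∎

  -- Bounding the maximum by `m` amounts to shrinking the alphabet: words with a larger letter are
  -- filtered out, and words over 1, ..., m pass the filter automatically.
  ∑-max≤-PF : ∀ n m f → m ≤ n → ∑ (filter (λ w → max 0 w ℕ.≤? m) (PF n)) f ≈
                                ∑[ w ∈ words [1⋯ m ] n ] (parking? w ▸ f w)
  ∑-max≤-PF n m f m≤n = begin
    ∑ (filter max≤m? (PF n)) f
      ≈⟨ ∑-filter max≤m? (PF n) f ⟩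
    (∑[ w ∈ PF n ] (max≤m? w ▸ f w))
      ≈⟨ ∑-filter (isParking? n) (words [1⋯ n ] n) _ ⟩
    (∑[ w ∈ words [1⋯ n ] n ] (isParking? n w ▸ max≤m? w ▸ f w))
      ≈⟨ ∑-words-restrict n _ m≤n (λ b w m<b b∈w → ▸-0 (isParking? n w)
           (▸-no (max≤m? w) (f w) λ max≤m → ℕ.<⇒≱ m<b (ℕ.≤-trans (All.lookup (xs≤max 0 w) b∈w) max≤m))) ⟩
    (∑[ w ∈ words [1⋯ m ] n ] (isParking? n w ▸ max≤m? w ▸ f w))
      ≈⟨ ∑-words-cong [1⋯ m ] n (λ where
           w refl w∈ → ▸-congˡ (parking? w) (▸-yes (max≤m? w) (f w) (max≤v⁺ z≤n (All.map ∈-[1⋯]⇒≤ w∈)))) ⟩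
    (∑[ w ∈ words [1⋯ m ] n ] (parking? w ▸ f w)) ∎
    where
    max≤m? : ∀ w → Dec (max 0 w ≤ m)
    max≤m? w = max 0 w ℕ.≤? m

  ∑-insertions-▸ : ∀ {P : Set} (P? : Dec P) m r v f →
    ∑-insertions m r v (λ w → P? ▸ f w) ≈ P? ▸ ∑-insertions m r v f
  ∑-insertions-▸ P? m r v f with does P?
  ... | true  = K.refl
  ... | false = ∑-insertions-0 {m} r v λ _ → K.refl

  -- By `parking-insert-max` all insertions into `v` are parking or none is, according to `v`; the
  -- bracket is therefore constant and leaves the sum.
  ∑-insertions-parking : ∀ m r v f → All (_≤ m) v → m ≤ suc (length v) →
    ∑-insertions m (suc r) v (λ w → parking? w ▸ f w) ≈ parking? v ▸ ∑-insertions m (suc r) v f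
  ∑-insertions-parking m r v f v≤m m≤ = trans
    (∑-insertions-cong {m} (suc r) v λ w w↭ → ▸-cong (parking? w) (parking? v)
      (mk⇔ (λ p → proj₁ (E.to (parking-resp-↭ w↭ p)))
           (λ p → parking-resp-↭ (↭-sym w↭) (E.from (p , m≤)))) K.refl)
    (∑-insertions-▸ (parking? v) m (suc r) v f)
    where module E = Equivalence (parking-insert-max r v≤m)

  -- The inserted letter is too large for the smallest position it could take after sorting.
  ∑-insertions-parking-0 : ∀ m r v (f : List ℕ → Carrier) → All (_≤ m) v → suc (length v) < m →
    ∑-insertions m (suc r) v (λ w → parking? w ▸ f w) ≈ 0#
  ∑-insertions-parking-0 m r v f v≤m l<m = trans
    (∑-insertions-cong {m} (suc r) v λ w w↭ → ▸-no (parking? w) (f w)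
      λ p → ℕ.<⇒≱ l<m (proj₂ (Equivalence.to (parking-insert-max r v≤m) (parking-resp-↭ w↭ p))))
    (∑-insertions-0 {m} (suc r) v λ _ → K.refl)

-- Algebra of the gap series

module RingIdentities {c ℓ} (S : CommutativeRing c ℓ) where

  open CommutativeRing S hiding (refl)
  private
    module S = CommutativeRing S
    module Solver = SemiringSolver commutativeSemiring
    module GP = GroupProperties +-group
  open SetoidReasoning setoid
  open Exp semiring using (_^_)

  -- Moving the last term to the left gives (1 - u z) x = y, and `d` inverts the factor. The
  -- difference `q` stays an atom for the semiring solver; the moved term is removed by
  -- cancellation.
  geometric-solution : ∀ {x y u z d} → (1# - u * z) * d ≈ 1# → x ≈ y + z * (u * x) → x ≈ d * y
  geometric-solution {x} {y} {u} {z} {d} qd≈1 x≈ = begin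
    x            ≈⟨ *-identityˡ x ⟨
    1# * x       ≈⟨ *-congʳ qd≈1 ⟨
    (q * d) * x  ≈⟨ solve 3 (λ q d x → ((q :* d) :* x) := (d :* (q :* x))) S.refl q d x ⟩
    d * (q * x)  ≈⟨ *-congˡ qx≈y ⟩
    d * y        ∎
    where
    open Solver
    q = 1# - u * z

    qx≈y : q * x ≈ y
    qx≈y = GP.∙-cancelʳ (z * (u * x)) (q * x) y (begin
      q * x + z * (u * x)  ≈⟨ solve 4 (λ q z u x → ((q :* x) :+ (z :* (u :* x))) := ((q :+ (u :* z)) :* x))
                                S.refl q z u x ⟩
      (q + u * z) * x      ≈⟨ *-congʳ (GP.//-rightDividesˡ (u * z) 1#) ⟩
      1# * x               ≈⟨ *-identityˡ x ⟩
      x                    ≈⟨ x≈ ⟩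
      y + z * (u * x)      ∎)

  module GapSeries (t u z d : Carrier) where

    -- With `d` = 1/(1 - u z), `𝒹` is the series of a nonempty interior gap: a lone inserted letter
    -- is a peak and gives t z, a run of k ≥ 2 gives u^(k-1) z^k. An empty gap adds 1 in `𝓐` and u
    -- in `𝓒`.
    𝒹 𝓔 𝓐 𝓑 𝓒 : Carrier
    𝒹 = t * z + u * z ^ 2 * d
    𝓔 = 1# + z * d
    𝓐 = 1# + t * z + u * z ^ 2 * d
    𝓒 = u + t * z + u * z ^ 2 * d
    𝓑 = 𝓐 ^ 2 + t - 1#

    -- On the left, the first inserted letter is followed either by another one and then a run of
    -- any length, or at once by the next original letter, which makes it a peak.
    gap : ∀ x → z * (z * (u * (d * x)) + t * x) ≈ 𝒹 * x
    gap = solve 5 (λ t u z d x → (z :* ((z :* (u :* (d :* x))) :+ (t :* x))) :=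
                                 (((t :* z) :+ ((u :* (z :* (z :* con 1))) :* d)) :* x)) S.refl t u z d
      where open Solver

    end-gap : ∀ x → z * (d * x) + x ≈ 𝓔 * x
    end-gap = solve 3 (λ z d x → ((z :* (d :* x)) :+ x) := ((con 1 :+ (z :* d)) :* x)) S.refl z d
      where open Solver

    flat-gap : ∀ x → 𝒹 * x + 1# * x ≈ 𝓐 * x
    flat-gap x = trans (sym (distribʳ x 𝒹 1#)) (*-congʳ (trans (+-comm 𝒹 1#) (sym (+-assoc _ _ _))))

    tie-gap : ∀ x → 𝒹 * x + u * x ≈ 𝓒 * x
    tie-gap x = trans (sym (distribʳ x 𝒹 u)) (*-congʳ (trans (+-comm 𝒹 u) (sym (+-assoc _ _ _))))

    -- The terms stand for: left gap filled; only the right gap filled; both empty, with the peak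
    -- kept. Since 𝒹 + 1 = 𝓐, they add up to 𝓐² - 1 + t. Adding `x` to both sides avoids
    -- subtraction.
    peak-gaps : ∀ x → 𝒹 * (𝓐 * x) + (𝒹 * x + t * x) ≈ 𝓑 * x
    peak-gaps x = GP.∙-cancelʳ x _ _ (begin
      (𝒹 * (𝓐 * x) + (𝒹 * x + t * x)) + x
        ≈⟨ solve 4 (λ D A t x → (((D :* (A :* x)) :+ ((D :* x) :+ (t :* x))) :+ x) :=
                                ((D :* (A :* x)) :+ (((D :* x) :+ (con 1 :* x)) :+ (t :* x)))) S.refl 𝒹 𝓐 t x ⟩
      𝒹 * (𝓐 * x) + ((𝒹 * x + 1# * x) + t * x)
        ≈⟨ +-congˡ (+-congʳ (flat-gap x)) ⟩
      𝒹 * (𝓐 * x) + (𝓐 * x + t * x)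
        ≈⟨ solve 4 (λ D A t x → ((D :* (A :* x)) :+ ((A :* x) :+ (t :* x))) :=
                                (((D :* (A :* x)) :+ (con 1 :* (A :* x))) :+ (t :* x))) S.refl 𝒹 𝓐 t x ⟩
      (𝒹 * (𝓐 * x) + 1# * (𝓐 * x)) + t * x
        ≈⟨ +-congʳ (flat-gap (𝓐 * x)) ⟩
      𝓐 * (𝓐 * x) + t * x
        ≈⟨ solve 3 (λ A t x → ((A :* (A :* x)) :+ (t :* x)) := (((A :* (A :* con 1)) :+ t) :* x)) S.refl 𝓐 t x ⟩
      (𝓐 ^ 2 + t) * x
        ≈⟨ *-congʳ (GP.//-rightDividesˡ 1# (𝓐 ^ 2 + t)) ⟨
      (𝓑 + 1#) * x
        ≈⟨ trans (distribʳ x 𝓑 1#) (+-congˡ (*-identityˡ x)) ⟩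
      𝓑 * x + x ∎)
      where open Solver

-- Coefficients of products with constants and with z

module SeriesCoefficients {c ℓ} (K : CommutativeRing c ℓ) where

  open CommutativeRing K hiding (refl)
  open PowerSeries K
  private
    module K = CommutativeRing K
    module S = CommutativeRing seriesRing

  const-*-coeff : ∀ a f n → (const a S.* f) n ≈ a * f n
  const-*-coeff a f zero    = +-identityʳ _
  const-*-coeff a f (suc n) = trans (+-congˡ (coeff-≈ (S.zeroˡ f) n)) (+-identityʳ _)

  z-*-coeff-zero : ∀ f → (z S.* f) 0 ≈ 0#
  z-*-coeff-zero f = trans (+-identityʳ _) (zeroˡ _)

  z-*-coeff-suc : ∀ f n → (z S.* f) (suc n) ≈ f n
  z-*-coeff-suc f n = trans (+-congʳ (zeroˡ _)) (trans (+-identityˡ _)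
    (trans (coeff-≈ (S.*-congʳ {f} {λ k → z (suc k)} {S.1#} (coeffwise tail-z)) n)
      (coeff-≈ (S.*-identityˡ f) n)))
    where
    tail-z : ∀ k → z (suc k) ≈ S.1# k
    tail-z zero    = K.refl
    tail-z (suc k) = K.refl

  const-* : ∀ a b → const (a * b) S.≈ const a S.* const b
  const-* a b = coeffwise λ n → trans (const-ab n) (sym (const-*-coeff a (const b) n))
    where
    const-ab : ∀ n → const (a * b) n ≈ a * const b n
    const-ab zero    = K.refl
    const-ab (suc n) = sym (zeroʳ a)

  const-+ : ∀ a b → const (a + b) S.≈ const a S.+ const b
  const-+ a b = coeffwise λ where
    zero    → K.refl
    (suc n) → sym (+-identityʳ 0#)

  const-0 : const 0# S.≈ S.0#
  const-0 = coeffwise λ where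
    zero    → K.refl
    (suc n) → K.refl

  const-cong : ∀ {a b} → a ≈ b → const a S.≈ const b
  const-cong a≈b = coeffwise λ where
    zero    → a≈b
    (suc n) → K.refl

-- The monomial of a word, read letter by letter

module Weight {c ℓ} (K : CommutativeRing c ℓ) (t u : CommutativeRing.Carrier K) where

  open CommutativeRing K hiding (refl; zero)
  open Exp semiring using (_^_; ^-homo-*)
  private
    module K = CommutativeRing K
    module Solver = SemiringSolver commutativeSemiring
  open SetoidReasoning setoid

  monomial : List ℕ → Carrier
  monomial w = t ^ pk w * u ^ tie w

  -- Whether `y` is a peak is settled only on reading the next letter `a`; the same step decides the
  -- tie.
  stepWeight : Bool → ℕ → ℕ → Carrier
  stepWeight up y a = t ^ (if up ∧ does (a ℕ.<? y) then 1 else 0) * u ^ indicator (y ℕ.≟ a)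

  -- The factor that w contributes to the monomial of a word … x y w, where up says
  -- whether x < y.
  weight : Bool → ℕ → List ℕ → Carrier
  weight up y []      = 1#
  weight up y (a ∷ w) = stepWeight up y a * weight (does (y ℕ.<? a)) a w

  -- The first letter is never a peak, and all that later factors need to know about `x` is whether
  -- it lies below `y`.
  monomial-∷∷ : ∀ x y w → monomial (x ∷ y ∷ w) ≈ u ^ indicator (x ℕ.≟ y) * weight (does (x ℕ.<? y)) y w
  monomial-∷∷ x y []      = begin
    1# * u ^ (indicator (x ℕ.≟ y) ℕ.+ 0)  ≡⟨ ≡.cong (λ i → 1# * u ^ i) (ℕ.+-identityʳ (indicator (x ℕ.≟ y))) ⟩
    1# * u ^ indicator (x ℕ.≟ y)          ≈⟨ *-comm _ _ ⟩
    u ^ indicator (x ℕ.≟ y) * 1#          ∎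
  monomial-∷∷ x y (v ∷ w) = begin
    t ^ (i ℕ.+ pk (y ∷ v ∷ w)) * u ^ (j ℕ.+ tie (y ∷ v ∷ w))
      ≈⟨ *-cong (^-homo-* t i (pk (y ∷ v ∷ w))) (^-homo-* u j (tie (y ∷ v ∷ w))) ⟩
    (t ^ i * t ^ pk (y ∷ v ∷ w)) * (u ^ j * u ^ tie (y ∷ v ∷ w))
      ≈⟨ solve 4 (λ a p b q → ((a :* p) :* (b :* q)) := (b :* (a :* (p :* q)))) K.refl _ _ _ _ ⟩
    u ^ j * (t ^ i * monomial (y ∷ v ∷ w))
      ≈⟨ *-congˡ (*-congˡ (monomial-∷∷ y v w)) ⟩
    u ^ j * (t ^ i * (u ^ indicator (y ℕ.≟ v) * weight (does (y ℕ.<? v)) v w))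
      ≈⟨ *-congˡ (*-assoc _ _ _) ⟨
    u ^ j * weight (does (x ℕ.<? y)) y (v ∷ w) ∎
    where
    open Solver
    i = if does (x ℕ.<? y) ∧ does (v ℕ.<? y) then 1 else 0
    j = indicator (x ℕ.≟ y)

  -- The flag starts as `false` because no rise leads to the first letter.
  monomial-∷ : ∀ y w → monomial (y ∷ w) ≈ weight false y w
  monomial-∷ y []      = *-identityˡ 1#
  monomial-∷ y (a ∷ w) = trans (monomial-∷∷ y a w) (*-congʳ (sym (*-identityˡ _)))

-- What the enumeration of insertions uses of the ring S = K⟦z⟧.  The map insertions m v
-- sends f to the series ∑ᵣ zʳ ∑ f(w), with w running over the insertions of r letters m
-- into v; the two recursions split off the first letter of w.
record InsertionFamily {c ℓ c′ ℓ′} (K : CommutativeRing c ℓ) (u : CommutativeRing.Carrier K)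
  (S : CommutativeRing c′ ℓ′) : Set (c ⊔ ℓ ⊔ c′ ⊔ ℓ′) where
  private
    module K = CommutativeRing K
    module S = CommutativeRing S
  field
    const            : K.Carrier → S.Carrier
    const-cong       : ∀ {a b} → a K.≈ b → const a S.≈ const b
    const-1          : const K.1# S.≈ S.1#
    z geom           : S.Carrier
    geom-inverse     : (S.1# S.- const u S.* z) S.* geom S.≈ S.1#
    insertions       : ℕ → List ℕ → (List ℕ → K.Carrier) → S.Carrier
    insertions-cong  : ∀ m v {f g} → (∀ w → f w K.≈ g w) → insertions m v f S.≈ insertions m v g
    insertions-scale : ∀ m v a f → insertions m v (λ w → a K.* f w) S.≈ const a S.* insertions m v f
    insertions-[]    : ∀ m f → insertions m [] f S.≈ const (f []) S.+ z S.* insertions m [] (f ∘ (m ∷_))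
    insertions-∷     : ∀ m a v f → insertions m (a ∷ v) f S.≈
                       z S.* insertions m (a ∷ v) (f ∘ (m ∷_)) S.+ insertions m v (f ∘ (a ∷_))

-- The gap product for insertions into a fixed word

module GeneratingFunction {c ℓ c′ ℓ′} (K : CommutativeRing c ℓ) (t u : CommutativeRing.Carrier K)
  (S : CommutativeRing c′ ℓ′) (family : InsertionFamily K u S) where

  open CommutativeRing K hiding (refl; zero)
  open Exp semiring using (_^_)
  open Weight K t u
  open InsertionFamily family
  private
    module K = CommutativeRing K
    module S = CommutativeRing S
    module Solver = SemiringSolver S.commutativeSemiring
    module RI = RingIdentities S
    module SR = SetoidReasoning S.setoid
  open Exp S.semiring using () renaming (_^_ to _^ᶻ_)
  open RI.GapSeries (const t) (const u) z geom public

  module _ (m : ℕ) where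

    -- The series of all continuations once `y` has been read and `v`, with inserted letters `m`, is
    -- still to come.
    G : Bool → ℕ → List ℕ → S.Carrier
    G up y v = insertions m v (weight up y)

    t^0 : ∀ up → t ^ (if up ∧ false then 1 else 0) ≈ 1#
    t^0 true  = K.refl
    t^0 false = K.refl

    weight-mm : ∀ up w → weight up m (m ∷ w) ≈ u * weight false m w
    weight-mm up w rewrite dec-false (m ℕ.<? m) (ℕ.<-irrefl refl) | dec-true (m ℕ.≟ m) refl =
      *-congʳ (trans (*-cong (t^0 up) (*-identityʳ u)) (*-identityˡ u))

    weight-ym : ∀ {y} up w → y < m → weight up y (m ∷ w) ≈ weight true m w
    weight-ym {y} up w y<m
      rewrite dec-true (y ℕ.<? m) y<m | dec-false (m ℕ.<? y) (ℕ.<⇒≯ y<m) | dec-false (y ℕ.≟ m) (ℕ.<⇒≢ y<m) =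
      trans (*-congʳ (trans (*-identityʳ _) (t^0 up))) (*-identityˡ _)

    -- Here the fate of an inserted letter is decided: followed by a smaller letter, it is a peak
    -- exactly if a rise led to it.
    weight-ma : ∀ {a} up w → a < m → weight up m (a ∷ w) ≈ t ^ (if up then 1 else 0) * weight false a w
    weight-ma {a} up w a<m
      rewrite dec-false (m ℕ.<? a) (ℕ.<⇒≯ a<m) | dec-true (a ℕ.<? m) a<m | dec-false (m ℕ.≟ a) (ℕ.>⇒≢ a<m) =
      *-congʳ (trans (*-identityʳ _) (t^ up))
      where
      t^ : ∀ up → t ^ (if up ∧ true then 1 else 0) ≈ t ^ (if up then 1 else 0)
      t^ true  = K.refl
      t^ false = K.refl

    after-m : ∀ up v → insertions m v (λ w → weight up m (m ∷ w)) S.≈ const u S.* G false m v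
    after-m up v = S.trans (insertions-cong m v (weight-mm up)) (insertions-scale m v u _)

    -- At the end of the word `m` cannot be a peak, so both flags satisfy the same equation; with
    -- flag `false` that equation is geometric.
    G-m-[] : ∀ up → G up m [] S.≈ geom
    G-m-[] up = S.trans (step up) (S.trans (S.sym (step false)) (S.trans
      (RI.geometric-solution {y = S.1#} geom-inverse (step false)) (S.*-identityʳ geom)))
      where
      step : ∀ up → G up m [] S.≈ S.1# S.+ z S.* (const u S.* G false m [])
      step up = S.trans (insertions-[] m _) (S.+-cong const-1 (S.*-congˡ (after-m up [])))

    G-m-∷ : ∀ {a} up v → a < m →
      G up m (a ∷ v) S.≈
      z S.* (const u S.* G false m (a ∷ v)) S.+ const (t ^ (if up then 1 else 0)) S.* G false a v
    G-m-∷ {a} up v a<m = S.trans (insertions-∷ m a v _) (S.+-cong (S.*-congˡ (after-m up (a ∷ v)))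
      (S.trans (insertions-cong m v λ w → weight-ma up w a<m) (insertions-scale m v _ _)))

    -- No peak can arise in this run, so the equation of `G-m-∷` closes up and further copies
    -- contribute the geometric series.
    G-m-false : ∀ {a} v → a < m → G false m (a ∷ v) S.≈ geom S.* G false a v
    G-m-false {a} v a<m = RI.geometric-solution geom-inverse
      (S.trans (G-m-∷ false v a<m) (S.trans (S.+-comm _ _)
        (S.+-congʳ (S.trans (S.*-congʳ const-1) (S.*-identityˡ _)))))

    G-m-true : ∀ {a} v → a < m →
      G true m (a ∷ v) S.≈ z S.* (const u S.* (geom S.* G false a v)) S.+ const t S.* G false a v
    G-m-true v a<m = S.trans (G-m-∷ true v a<m)
      (S.+-cong (S.*-congˡ (S.*-congˡ (G-m-false v a<m))) (S.*-congʳ (const-cong (*-identityʳ t))))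

    G-[] : ∀ {y} up → y < m → G up y [] S.≈ 𝓔
    G-[] up y<m = S.trans (insertions-[] m _) (S.+-cong const-1 (S.*-congˡ
      (S.trans (insertions-cong m [] λ w → weight-ym up w y<m) (G-m-[] true))))

    -- The gap between `y` and `a` is either filled, so that `a` is reached by a descent and its
    -- flag is `false`, or empty, so that the original step from `y` to `a` remains.
    G-∷ : ∀ {y a} up v → y < m → a < m →
      G up y (a ∷ v) S.≈ 𝒹 S.* G false a v S.+ const (stepWeight up y a) S.* G (does (y ℕ.<? a)) a v
    G-∷ {y} {a} up v y<m a<m = SR.begin
      G up y (a ∷ v)
        SR.≈⟨ insertions-∷ m a v _ ⟩
      z S.* insertions m (a ∷ v) (λ w → weight up y (m ∷ w)) S.+ insertions m v (λ w → weight up y (a ∷ w))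
        SR.≈⟨ S.+-cong (S.*-congˡ (S.trans (insertions-cong m (a ∷ v) λ w → weight-ym up w y<m)
                                            (G-m-true v a<m)))
                       (insertions-scale m v _ _) ⟩
      z S.* (z S.* (const u S.* (geom S.* G false a v)) S.+ const t S.* G false a v)
        S.+ const (stepWeight up y a) S.* G (does (y ℕ.<? a)) a v
        SR.≈⟨ S.+-congʳ (gap (G false a v)) ⟩
      𝒹 S.* G false a v S.+ const (stepWeight up y a) S.* G (does (y ℕ.<? a)) a v SR.∎

    -- The flag matters only if a smaller letter follows `y`, but neither `a` nor an inserted `m` is
    -- smaller.
    G-≯ : ∀ {y a} v → y < m → a < m → ¬ a < y → G true y (a ∷ v) S.≈ G false y (a ∷ v)
    G-≯ {y} {a} v y<m a<m a≮y = S.trans (G-∷ true v y<m a<m) (S.trans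
      (S.+-congˡ (S.*-congʳ (const-cong (*-congʳ (reflexive (≡.cong (λ b → t ^ (if b then 1 else 0))
        (dec-false (a ℕ.<? y) a≮y)))))))
      (S.sym (G-∷ false v y<m a<m)))

    -- The last hypothesis says that filling the gap changes nothing after `a`; the factors 𝒹 and 1
    -- of a filled and an empty gap then add up to 𝓐.
    G-flat : ∀ {y a} v → y < m → a < m → y ≢ a →
             G (does (y ℕ.<? a)) a v S.≈ G false a v → G false y (a ∷ v) S.≈ 𝓐 S.* G false a v
    G-flat {y} {a} v y<m a<m y≢a G≈ = S.trans (G-∷ false v y<m a<m) (S.trans
      (S.+-congˡ (S.*-cong (S.trans (const-cong (trans (*-identityˡ _)
        (reflexive (≡.cong (λ b → u ^ (if b then 1 else 0)) (dec-false (y ℕ.≟ a) y≢a))))) const-1) G≈))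
      (flat-gap (G false a v)))

    G-tie : ∀ {y} v → y < m → G false y (y ∷ v) S.≈ 𝓒 S.* G false y v
    G-tie {y} v y<m = S.trans (G-∷ false v y<m y<m) (S.trans
      (S.+-congˡ (S.*-cong
        (const-cong (trans (*-identityˡ _) (trans
          (reflexive (≡.cong (λ b → u ^ (if b then 1 else 0)) (dec-true (y ℕ.≟ y) refl))) (*-identityʳ u))))
        (S.reflexive (≡.cong (λ b → G b y v) (dec-false (y ℕ.<? y) (ℕ.<-irrefl refl))))))
      (tie-gap (G false y v)))

    -- The gaps on both sides of the peak `a` are treated together, because filling either of them
    -- destroys it.
    G-peak : ∀ {y a b} v → y < m → a < m → b < m → y < a → b < a →
             G false y (a ∷ b ∷ v) S.≈ 𝓑 S.* G false b v
    G-peak {y} {a} {b} v y<m a<m b<m y<a b<a = SR.begin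
      G false y (a ∷ b ∷ v)
        SR.≈⟨ G-∷ false (b ∷ v) y<m a<m ⟩
      𝒹 S.* G false a (b ∷ v) S.+ const (stepWeight false y a) S.* G (does (y ℕ.<? a)) a (b ∷ v)
        -- If the left gap is filled, the right one is flat and gives 𝓐; if it is empty, `a` keeps
        -- its rise and the flag becomes `true`.
        SR.≈⟨ S.+-cong (S.*-congˡ (G-flat v a<m b<m (ℕ.>⇒≢ b<a) (S.reflexive (≡.cong (λ c → G c b v) a≮b))))
                (S.trans (S.*-cong (S.trans (const-cong step₁) const-1)
                                   (S.reflexive (≡.cong (λ c → G c a (b ∷ v)) (dec-true (y ℕ.<? a) y<a))))
                         (S.*-identityˡ _)) ⟩
      𝒹 S.* (𝓐 S.* G false b v) S.+ G true a (b ∷ v)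
        SR.≈⟨ S.+-congˡ (S.trans (G-∷ true v a<m b<m) (S.+-congˡ
                (S.*-cong (const-cong step₂) (S.reflexive (≡.cong (λ c → G c b v) a≮b))))) ⟩
      𝒹 S.* (𝓐 S.* G false b v) S.+ (𝒹 S.* G false b v S.+ const t S.* G false b v)
        SR.≈⟨ peak-gaps (G false b v) ⟩
      𝓑 S.* G false b v SR.∎
      where
      a≮b : does (a ℕ.<? b) ≡ false
      a≮b = dec-false (a ℕ.<? b) (ℕ.<⇒≯ b<a)

      step₁ : stepWeight false y a ≈ 1#
      step₁ rewrite dec-false (y ℕ.≟ a) (ℕ.<⇒≢ y<a) = *-identityˡ 1#

      step₂ : stepWeight true a b ≈ t
      step₂ rewrite dec-true (b ℕ.<? a) b<a | dec-false (a ℕ.≟ b) (ℕ.>⇒≢ b<a) =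
        trans (*-identityʳ _) (*-identityʳ t)

    -- `P` and `Q` play the roles of 𝓑/𝓐² and 𝓒/𝓐, specified by their products so that the argument
    -- is free of division.
    module _ {P Q : S.Carrier} (𝓐²P≈𝓑 : 𝓐 ^ᶻ 2 S.* P S.≈ 𝓑) (𝓐Q≈𝓒 : 𝓐 S.* Q S.≈ 𝓒) where

      -- There is a single 𝓔, for the gap at the end; the gap before the first letter is added in
      -- `insertions-monomial`.
      product : ℕ → ℕ → ℕ → S.Carrier
      product l p q = 𝓔 S.* (𝓐 ^ᶻ l S.* (P ^ᶻ p S.* Q ^ᶻ q))

      product-𝓐 : ∀ l p q → 𝓐 S.* product l p q S.≈ product (suc l) p q
      product-𝓐 l p q = solve 4 (λ A E Aˡ PQ → (A :* (E :* (Aˡ :* PQ))) := (E :* ((A :* Aˡ) :* PQ)))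
        S.refl 𝓐 𝓔 (𝓐 ^ᶻ l) (P ^ᶻ p S.* Q ^ᶻ q)
        where open Solver

      product-𝓒 : ∀ l p q → 𝓒 S.* product l p q S.≈ product (suc l) p (suc q)
      product-𝓒 l p q = S.trans (S.*-congʳ (S.sym 𝓐Q≈𝓒))
        (solve 6 (λ A Q E Aˡ Pᵖ Q^q → ((A :* Q) :* (E :* (Aˡ :* (Pᵖ :* Q^q)))) :=
                                   (E :* ((A :* Aˡ) :* (Pᵖ :* (Q :* Q^q)))))
          S.refl 𝓐 Q 𝓔 (𝓐 ^ᶻ l) (P ^ᶻ p) (Q ^ᶻ q))
        where open Solver

      product-𝓑 : ∀ l p q → 𝓑 S.* product l p q S.≈ product (suc (suc l)) (suc p) q
      product-𝓑 l p q = S.trans (S.*-congʳ (S.sym 𝓐²P≈𝓑))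
        (solve 6 (λ A P E Aˡ Pᵖ Q^q → (((A :* (A :* con 1)) :* P) :* (E :* (Aˡ :* (Pᵖ :* Q^q)))) :=
                                   (E :* ((A :* (A :* Aˡ)) :* ((P :* Pᵖ) :* Q^q))))
          S.refl 𝓐 P 𝓔 (𝓐 ^ᶻ l) (P ^ᶻ p) (Q ^ᶻ q))
        where open Solver

      productOf : ℕ → List ℕ → S.Carrier
      productOf y v = product (length v) (pk (y ∷ v)) (tie (y ∷ v))

      product-cong : ∀ l {p p′ q q′} → p ≡ p′ → q ≡ q′ → product l p q S.≈ product l p′ q′
      product-cong l refl refl = S.refl

      extend-𝓐 : ∀ {x} y a v → x S.≈ productOf a v →
                 pk (y ∷ a ∷ v) ≡ pk (a ∷ v) → tie (y ∷ a ∷ v) ≡ tie (a ∷ v) →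
                 𝓐 S.* x S.≈ productOf y (a ∷ v)
      extend-𝓐 y a v x≈ pk≡ tie≡ = S.trans (S.*-congˡ x≈)
        (S.trans (product-𝓐 (length v) (pk (a ∷ v)) (tie (a ∷ v)))
                 (product-cong (suc (length v)) (≡.sym pk≡) (≡.sym tie≡)))

      extend-𝓒 : ∀ {x} y v → x S.≈ productOf y v → 𝓒 S.* x S.≈ productOf y (y ∷ v)
      extend-𝓒 y v x≈ = S.trans (S.*-congˡ x≈)
        (S.trans (product-𝓒 (length v) (pk (y ∷ v)) (tie (y ∷ v)))
                 (product-cong (suc (length v)) (≡.sym (pk-≮ v (ℕ.<-irrefl refl))) (≡.sym (tie-≡ y v))))

      extend-𝓑 : ∀ {x y a b} v → y < a → b < a → x S.≈ productOf b v →
                 𝓑 S.* x S.≈ productOf y (a ∷ b ∷ v)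
      extend-𝓑 {b = b} v y<a b<a x≈ = S.trans (S.*-congˡ x≈)
        (S.trans (product-𝓑 (length v) (pk (b ∷ v)) (tie (b ∷ v)))
                 (product-cong (suc (suc (length v))) (≡.sym (pk-peak v y<a b<a))
                   (≡.sym (≡.trans (tie-≢ (b ∷ v) (ℕ.<⇒≢ y<a)) (tie-≢ v (ℕ.>⇒≢ b<a))))))

      -- If `b` is below `a`, both gaps around the peak `a` are consumed at once and the hypothesis
      -- two letters further on is used. Otherwise the rise to `a` has no effect and the gap before
      -- it is flat.
      G-rise : ∀ {y a b} v → y < m → a < m → b < m → y < a →
               G false b v S.≈ productOf b v → G false a (b ∷ v) S.≈ productOf a (b ∷ v) →
               G false y (a ∷ b ∷ v) S.≈ productOf y (a ∷ b ∷ v)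
      G-rise {y} {a} {b} v y<m a<m b<m y<a IH IH′ with b ℕ.<? a
      ... | yes b<a = S.trans (G-peak v y<m a<m b<m y<a b<a) (extend-𝓑 v y<a b<a IH)
      ... | no b≮a = S.trans
        (G-flat (b ∷ v) y<m a<m (ℕ.<⇒≢ y<a)
          (S.trans (S.reflexive (≡.cong (λ c → G c a (b ∷ v)) (dec-true (y ℕ.<? a) y<a)))
                   (G-≯ v a<m b<m b≮a)))
        (extend-𝓐 y a (b ∷ v) IH′ (pk-≯ v b≮a) (tie-≢ (b ∷ v) (ℕ.<⇒≢ y<a)))

      -- Induction on `v`, comparing `y` with the next letter: a tie gives 𝓒, a descent 𝓐, and a
      -- rise needs one more letter of lookahead.
      G-false : ∀ {y} v → y < m → All (_< m) v → G false y v S.≈ productOf y v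
      G-false {y} [] y<m [] = S.trans (G-[] false y<m)
        (solve 1 (λ E → E := (E :* (con 1 :* (con 1 :* con 1)))) S.refl 𝓔)
        where open Solver
      G-false {y} (a ∷ v) y<m (a<m ∷ v<m) with ℕ.<-cmp y a
      ... | tri≈ _ refl _ = S.trans (G-tie v y<m) (extend-𝓒 y v (G-false v y<m v<m))
      ... | tri> y≮a y≢a _ = S.trans
        (G-flat v y<m a<m y≢a (S.reflexive (≡.cong (λ b → G b a v) (dec-false (y ℕ.<? a) y≮a))))
        (extend-𝓐 y a v (G-false v a<m v<m) (pk-≮ v y≮a) (tie-≢ v y≢a))
      -- A rise to the last letter makes no peak: only the end gap follows, which gives 𝓔 for either
      -- flag.
      G-false {y} (a ∷ []) y<m (a<m ∷ []) | tri< y<a y≢a _ = S.trans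
        (G-flat [] y<m a<m y≢a (S.trans (G-[] _ a<m) (S.sym (G-[] false a<m))))
        (extend-𝓐 y a [] (G-false [] a<m []) refl (tie-≢ [] y≢a))
      G-false (a ∷ b ∷ v) y<m (a<m ∷ b<m ∷ v<m) | tri< y<a _ _ =
        G-rise v y<m a<m b<m y<a (G-false v b<m v<m) (G-false (b ∷ v) a<m (b<m ∷ v<m))

      -- The gap before the first letter supplies the second 𝓔: it is empty or holds a run, in which
      -- the initial `m` is never a peak.
      insertions-monomial : ∀ v → All (_< m) v → 1 ≤ length v →
        insertions m v monomial S.≈ 𝓔 ^ᶻ 2 S.* 𝓐 ^ᶻ (length v ∸ 1) S.* (P ^ᶻ pk v S.* Q ^ᶻ tie v)
      insertions-monomial (a ∷ v) (a<m ∷ v<m) _ = SR.begin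
        insertions m (a ∷ v) monomial
          SR.≈⟨ insertions-∷ m a v monomial ⟩
        z S.* insertions m (a ∷ v) (λ w → monomial (m ∷ w)) S.+ insertions m v (λ w → monomial (a ∷ w))
          SR.≈⟨ S.+-cong (S.*-congˡ (S.trans (insertions-cong m (a ∷ v) (monomial-∷ m)) (G-m-false v a<m)))
                         (insertions-cong m v (monomial-∷ a)) ⟩
        z S.* (geom S.* G false a v) S.+ G false a v
          SR.≈⟨ S.trans (end-gap (G false a v)) (S.*-congˡ (G-false v a<m v<m)) ⟩
        𝓔 S.* productOf a v
          SR.≈⟨ solve 3 (λ E A PQ → (E :* (E :* (A :* PQ))) := (((E :* (E :* con 1)) :* A) :* PQ)) S.refl 𝓔 _ _ ⟩
        𝓔 ^ᶻ 2 S.* 𝓐 ^ᶻ length v S.* (P ^ᶻ pk (a ∷ v) S.* Q ^ᶻ tie (a ∷ v)) SR.∎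
        where open Solver

-- Insertions as formal power series

module InsertionSeries {c ℓ} (K : CommutativeRing c ℓ) (t u : CommutativeRing.Carrier K) where

  open CommutativeRing K hiding (refl; zero)
  open PowerSeries K
  open Sums K
  open SeriesCoefficients K
  private
    module K = CommutativeRing K
    module S = CommutativeRing seriesRing
  open Exp S.semiring using () renaming (_^_ to _^ᶻ_)

  geom : Series
  geom = (S.1# S.- const u S.* z) ⁻¹

  geom-inverse : (S.1# S.- const u S.* z) S.* geom S.≈ S.1#
  geom-inverse = ⁻¹-inverseʳ (S.1# S.- const u S.* z)
    (trans (+-congˡ (trans (-‿cong (trans (const-*-coeff u z 0) (zeroʳ u))) RP.-0#≈0#)) (+-identityʳ 1#))
    where module RP = RingProperties ring

  insertions : ℕ → List ℕ → (List ℕ → Carrier) → Series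
  insertions m v f r = ∑-insertions m r v f

  insertions-cong : ∀ m v {f g} → (∀ w → f w ≈ g w) → insertions m v f S.≈ insertions m v g
  insertions-cong m v f≈g = coeffwise λ r → ∑-insertions-cong r v λ w _ → f≈g w

  insertions-scale : ∀ m v a f → insertions m v (λ w → a * f w) S.≈ const a S.* insertions m v f
  insertions-scale m v a f =
    coeffwise λ r → trans (go r v f) (sym (const-*-coeff a (insertions m v f) r))
    where
    go : ∀ r v f → ∑-insertions m r v (λ w → a * f w) ≈ a * ∑-insertions m r v f
    go zero    v       f = K.refl
    go (suc r) []      f = go r [] (f ∘ (m ∷_))
    go (suc r) (b ∷ v) f = trans
      (+-cong (go r (b ∷ v) (f ∘ (m ∷_))) (go (suc r) v (f ∘ (b ∷_)))) (sym (distribˡ a _ _))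

  insertions-[] : ∀ m f → insertions m [] f S.≈ const (f []) S.+ z S.* insertions m [] (f ∘ (m ∷_))
  insertions-[] m f = coeffwise λ where
    zero    → sym (trans (+-congˡ (z-*-coeff-zero (insertions m [] (f ∘ (m ∷_))))) (+-identityʳ _))
    (suc r) → sym (trans (+-identityˡ _) (z-*-coeff-suc (insertions m [] (f ∘ (m ∷_))) r))

  insertions-∷ : ∀ m a v f →
    insertions m (a ∷ v) f S.≈ z S.* insertions m (a ∷ v) (f ∘ (m ∷_)) S.+ insertions m v (f ∘ (a ∷_))
  insertions-∷ m a v f = coeffwise λ where
    zero    → sym (trans (+-congʳ (z-*-coeff-zero (insertions m (a ∷ v) (f ∘ (m ∷_))))) (+-identityˡ _))
    (suc r) → sym (+-congʳ (z-*-coeff-suc (insertions m (a ∷ v) (f ∘ (m ∷_))) r))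

  insertionFamily : InsertionFamily K u seriesRing
  insertionFamily = record
    { const            = const
    ; const-cong       = const-cong
    ; const-1          = S.refl
    ; z                = z
    ; geom             = geom
    ; geom-inverse     = geom-inverse
    ; insertions       = insertions
    ; insertions-cong  = insertions-cong
    ; insertions-scale = insertions-scale
    ; insertions-[]    = insertions-[]
    ; insertions-∷     = insertions-∷
    }

  open GeneratingFunction K t u seriesRing insertionFamily public

  -- Both terms after 1 have a factor `z`, hence constant term 0.
  𝓐-constant-term : 𝓐 0 ≈ 1#
  𝓐-constant-term = trans (+-cong
      (trans (+-congˡ (trans (const-*-coeff t z 0) (zeroʳ t))) (+-identityʳ 1#))
      (trans (coeff-≈ z-factor 0) (z-*-coeff-zero (z ^ᶻ 1 S.* const u S.* geom))))
    (+-identityʳ 1#)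
    where
    z-factor : const u S.* z ^ᶻ 2 S.* geom S.≈ z S.* (z ^ᶻ 1 S.* const u S.* geom)
    z-factor = solve 4 (λ u z z′ d → ((u :* (z :* z′)) :* d) := (z :* ((z′ :* u) :* d)))
      S.refl (const u) z (z ^ᶻ 1) geom
      where open SemiringSolver S.commutativeSemiring

  𝓐²-constant-term : (𝓐 ^ᶻ 2) 0 ≈ 1#
  𝓐²-constant-term = trans (+-identityʳ _) (trans
    (*-cong 𝓐-constant-term (trans (+-identityʳ _) (trans (*-identityʳ _) 𝓐-constant-term))) (*-identityʳ 1#))

  *-/-cancel : ∀ f g → g 0 ≈ 1# → g S.* (f / g) S.≈ f
  *-/-cancel f g g₀≈1 = S.trans (x∙yz≈y∙xz g f (g ⁻¹))
    (S.trans (S.*-congˡ {f} (⁻¹-inverseʳ g g₀≈1)) (S.*-identityʳ f))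
    where open CommutativeSemigroupProperties S.*-commutativeSemigroup using (x∙yz≈y∙xz)

  -- E, A, B and C are variables so that the instance at R[t,u] is not compared with the
  -- series of Insertion by unfolding 𝓔, 𝓐, 𝓑 and 𝓒.
  insertions-monomial-/ : ∀ {E A B C} → E ≡ 𝓔 → A ≡ 𝓐 → B ≡ 𝓑 → C ≡ 𝓒 →
    ∀ m v → All (_< m) v → 1 ≤ length v → insertions m v (Weight.monomial K t u) S.≈
    E ^ᶻ 2 S.* A ^ᶻ (length v ∸ 1) S.* ((B / A ^ᶻ 2) ^ᶻ pk v S.* (C / A) ^ᶻ tie v)
  insertions-monomial-/ refl refl refl refl m = insertions-monomial m
    (*-/-cancel 𝓑 (𝓐 ^ᶻ 2) 𝓐²-constant-term) (*-/-cancel 𝓒 𝓐 𝓐-constant-term)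

-- Evaluation of polynomials and substitution

record PreservesSemiring {c ℓ c′ ℓ′} (A : CommutativeRing c ℓ) (S : CommutativeRing c′ ℓ′)
  (φ : CommutativeRing.Carrier A → CommutativeRing.Carrier S) : Set (c ⊔ ℓ′) where
  private
    module A = CommutativeRing A
    module S = CommutativeRing S
  field
    +-homo : ∀ a b → φ (a A.+ b) S.≈ φ a S.+ φ b
    *-homo : ∀ a b → φ (a A.* b) S.≈ φ a S.* φ b
    0-homo : φ A.0# S.≈ S.0#
    1-homo : φ A.1# S.≈ S.1#

  open Exp A.semiring using () renaming (_^_ to _^ᴬ_)
  open Exp S.semiring using () renaming (_^_ to _^ˢ_)

  ^-homo : ∀ a n → φ (a ^ᴬ n) S.≈ φ a ^ˢ n
  ^-homo a zero    = 1-homo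
  ^-homo a (suc n) = S.trans (*-homo a (a ^ᴬ n)) (S.*-congˡ (^-homo a n))

module Evaluation {c ℓ c′ ℓ′} (A : CommutativeRing c ℓ) (S : CommutativeRing c′ ℓ′)
  {φ : CommutativeRing.Carrier A → CommutativeRing.Carrier S} (φ-homo : PreservesSemiring A S φ)
  (x : CommutativeRing.Carrier S) where

  private
    module A = CommutativeRing A
    module S = CommutativeRing S
  open CommutativeRing S hiding (refl)
  open Polynomial A
  open PreservesSemiring φ-homo
  open CommutativeSemigroupProperties *-commutativeSemigroup using (x∙yz≈y∙xz)
  open CommutativeSemigroupProperties +-commutativeSemigroup using (interchange)

  eval : Poly → Carrier
  eval = evaluate S φ x

  eval-+ : ∀ p q → eval (p +ₚ q) ≈ eval p + eval q
  eval-+ []      q       = sym (+-identityˡ _)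
  eval-+ (a ∷ p) []      = sym (+-identityʳ _)
  eval-+ (a ∷ p) (b ∷ q) = trans
    (+-cong (+-homo a b) (trans (*-congˡ (eval-+ p q)) (distribˡ x _ _))) (interchange _ _ _ _)

  eval-scale : ∀ a q → eval (map (a A.*_) q) ≈ φ a * eval q
  eval-scale a []      = sym (zeroʳ _)
  eval-scale a (b ∷ q) = trans
    (+-cong (*-homo a b) (trans (*-congˡ (eval-scale a q)) (x∙yz≈y∙xz x (φ a) (eval q))))
    (sym (distribˡ (φ a) _ _))

  eval-* : ∀ p q → eval (p *ₚ q) ≈ eval p * eval q
  eval-* []      q = sym (zeroˡ _)
  eval-* (a ∷ p) q = trans (eval-+ (map (a A.*_) q) (A.0# ∷ p *ₚ q)) (trans
    (+-cong (eval-scale a q) (trans (+-cong 0-homo (*-congˡ (eval-* p q)))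
      (trans (+-identityˡ _) (sym (*-assoc x (eval p) (eval q))))))
    (sym (distribʳ (eval q) (φ a) (x * eval p))))

  eval-constant : ∀ a → eval (constant a) ≈ φ a
  eval-constant a = trans (+-congˡ (zeroʳ x)) (+-identityʳ (φ a))

  eval-X : eval X ≈ x
  eval-X = trans (+-cong 0-homo (*-congˡ (trans (eval-constant A.1#) 1-homo)))
    (trans (+-identityˡ _) (*-identityʳ x))

  -- This lets evaluation be iterated: first in t on the coefficients, then in u.
  eval-homo : PreservesSemiring polyRing S eval
  eval-homo = record
    { +-homo = eval-+
    ; *-homo = eval-*
    ; 0-homo = S.refl
    ; 1-homo = trans (eval-constant A.1#) 1-homo
    }

module Constant {c ℓ} (A : CommutativeRing c ℓ) where

  open CommutativeRing A hiding (refl)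
  open Polynomial A
  private
    module A = CommutativeRing A
    module P = CommutativeRing polyRing

  constant-cong : ∀ {a b} → a ≈ b → constant a P.≈ constant b
  constant-cong a≈b = coeffwise λ where
    zero    → a≈b
    (suc _) → A.refl

  constant-* : ∀ a b → constant (a * b) P.≈ constant a P.* constant b
  constant-* a b = coeffwise λ where
    zero    → sym (+-identityʳ _)
    (suc _) → A.refl

  constant-0 : constant 0# P.≈ P.0#
  constant-0 = coeffwise λ where
    zero    → A.refl
    (suc _) → A.refl

module Substitution {c ℓ c′ ℓ′} (R : CommutativeRing c ℓ) (S : CommutativeRing c′ ℓ′)
  {ψ : CommutativeRing.Carrier R → CommutativeRing.Carrier S} (ψ-homo : PreservesSemiring R S ψ)
  (x y : CommutativeRing.Carrier S) where

  private
    module R[t] = Polynomial R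
    module I = Insertion R
    module Inner = Evaluation R S ψ-homo x
    module Outer = Evaluation R[t].polyRing S Inner.eval-homo y
  open CommutativeRing S hiding (refl)
  open Exp semiring using (_^_; ^-congˡ)
  open PreservesSemiring Outer.eval-homo

  eval-monomial : ∀ i j → Outer.eval (I.t I.^ i I.* I.u I.^ j) ≈ x ^ i * y ^ j
  eval-monomial i j = trans (*-homo (I.t I.^ i) (I.u I.^ j)) (*-cong
    (trans (^-homo I.t i) (^-congˡ i (trans (Outer.eval-constant R[t].X) Inner.eval-X)))
    (trans (^-homo I.u j) (^-congˡ j Outer.eval-X)))

  -- Linearity, with the outer factor `b` carried inside so that each monomial yields its own
  -- series.
  *-eval-∑-monomials : ∀ {B : Set} b (ws : List B) (p q : B → ℕ) →
    b * Outer.eval (I.∑ ws λ w → I.t I.^ p w I.* I.u I.^ q w) ≈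
    foldr (λ w s → b * (x ^ p w * y ^ q w) + s) 0# ws
  *-eval-∑-monomials b []       p q = zeroʳ b
  *-eval-∑-monomials b (w ∷ ws) p q = trans (*-congˡ (+-homo (I.t I.^ p w I.* I.u I.^ q w) _))
    (trans (distribˡ b _ _) (+-cong (*-congˡ (eval-monomial (p w) (q w))) (*-eval-∑-monomials b ws p q)))

-- The insertion operator on sums of monomials

module InsertionOperator {c ℓ} (R : CommutativeRing c ℓ) where

  open Insertion R
  open Series
  private
    module K = CommutativeRing R[t,u]-ring
    module S = CommutativeRing R[t,u]⟦z⟧
    module C = Constant R
    module C′ = Constant (Polynomial.polyRing R)
  open SeriesCoefficients R[t,u]-ring

  const-scalar-homo : PreservesSemiring R R[t,u]⟦z⟧ (λ a → const (scalar a))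
  const-scalar-homo = record
    { +-homo = λ a b → const-+ (scalar a) (scalar b)
    ; *-homo = λ a b → S.trans
        (const-cong (K.trans (C′.constant-cong (C.constant-* a b))
          (C′.constant-* (Polynomial.constant R a) (Polynomial.constant R b))))
        (const-* (scalar a) (scalar b))
    ; 0-homo = S.trans (const-cong (K.trans (C′.constant-cong C.constant-0) C′.constant-0)) const-0
    ; 1-homo = S.refl
    }

  coeff-foldr : ∀ {B : Set} (f : B → Carrierᶻ) ws r → foldr (λ w s → f w +ᶻ s) S.0# ws r ≈ (∑[ w ∈ ws ] f w r)
  coeff-foldr f []       r = K.refl
  coeff-foldr f (w ∷ ws) r = K.+-congˡ (coeff-foldr f ws r)

  -- The series from which `𝓘 l r` extracts its value at the monomial t^p u^q.
  insertionTerm : ℕ → ℕ → ℕ → Carrierᶻ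
  insertionTerm l p q = 𝓔 ^ᶻ 2 *ᶻ 𝓐 ^ᶻ (l ∸ 1) *ᶻ ((𝓑 / 𝓐 ^ᶻ 2) ^ᶻ p *ᶻ (𝓒 / 𝓐) ^ᶻ q)

  𝓘-∑-monomials : ∀ {B : Set} l r (ws : List B) (p q : B → ℕ) →
    𝓘 l r (∑[ w ∈ ws ] (t ^ p w * u ^ q w)) ≈ (∑[ w ∈ ws ] insertionTerm l (p w) (q w) r)
  𝓘-∑-monomials l r ws p q = K.trans
    (PowerSeries.coeff-≈ (Substitution.*-eval-∑-monomials R R[t,u]⟦z⟧ const-scalar-homo (𝓑 / 𝓐 ^ᶻ 2) (𝓒 / 𝓐)
      (𝓔 ^ᶻ 2 *ᶻ 𝓐 ^ᶻ (l ∸ 1)) ws p q) r)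
    (coeff-foldr (λ w → insertionTerm l (p w) (q w)) ws r)

  insertions-insertionTerm : ∀ m v → All (_< m) v → 1 ≤ length v →
    InsertionSeries.insertions R[t,u]-ring t u m v (Weight.monomial R[t,u]-ring t u) ≈ᶻ
    insertionTerm (length v) (pk v) (tie v)
  insertions-insertionTerm = InsertionSeries.insertions-monomial-/ R[t,u]-ring t u
    {𝓔} {𝓐} {𝓑} {𝓒} refl refl refl refl

  ∑-insertions-monomial : ∀ m r v → All (_< m) v → 1 ≤ length v →
    Sums.∑-insertions R[t,u]-ring m r v (Weight.monomial R[t,u]-ring t u) ≈
    insertionTerm (length v) (pk v) (tie v) r
  ∑-insertions-monomial m r v v<m 1≤l = PowerSeries.coeff-≈ (insertions-insertionTerm m v v<m 1≤l) r

-- The recursion in m and its initial condition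

theorem1p2 : ∀ {c ℓ} (R : CommutativeRing c ℓ) → let open Insertion R in
    (∀ n m → 2 ≤ m → m ≤ n →
    H n m ≈ H n (m ∸ 1) + (∑[ r ∈ [1⋯ n ∸ m +ℕ 1 ] ] 𝓘 (n ∸ r) r (H (n ∸ r) (m ∸ 1))))
    × (∀ n → 1 ≤ n → H n 1 ≈ u ^ (n ∸ 1))
theorem1p2 R = recursion , initial
  where
  open Insertion R
  open Series
  module K = CommutativeRing R[t,u]-ring
  open Sums R[t,u]-ring
    using (_▸_; ▸-congˡ; ▸-yes; antidiagonal; antidiagonal-truncate; ∑-0; ∑-insertions; ∑-insertions-words; ∑-map;
      ∑-words-∷ʳ; ∑-words-cong; ∑-words-singleton)
  open ParkingSums R[t,u]-ring
  open Weight R[t,u]-ring t u using (monomial)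
  open InsertionOperator R
  open SetoidReasoning K.setoid

  parkingMonomial : List ℕ → Carrier
  parkingMonomial w = parking? w ▸ monomial w

  H-words : ∀ n m → m ≤ n → H n m ≈ (∑[ w ∈ words [1⋯ m ] n ] parkingMonomial w)
  H-words n m = ∑-max≤-PF n m monomial

  -- As m ≤ k, an insertion of letters `suc m` is parking exactly if `v` is. Each parking `v` then
  -- contributes its gap product, and linearity of `𝓘` collects these.
  insertions-𝓘 : ∀ m k r → 1 ≤ m → m ≤ k →
    ∑-insertions-words [1⋯ m ] (suc m) parkingMonomial k (suc r) ≈ 𝓘 k (suc r) (H k m)
  insertions-𝓘 m k r 1≤m m≤k = begin
    (∑[ v ∈ words [1⋯ m ] k ] ∑-insertions (suc m) (suc r) v parkingMonomial)
      ≈⟨ ∑-words-cong [1⋯ m ] k (λ where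
           v refl v∈ → K.trans
             (∑-insertions-parking (suc m) r v monomial (All.map (ℕ.m≤n⇒m≤1+n ∘ ∈-[1⋯]⇒≤) v∈) (s≤s m≤k))
             (▸-congˡ (parking? v) (∑-insertions-monomial (suc m) (suc r) v
               (All.map (s≤s ∘ ∈-[1⋯]⇒≤) v∈) (ℕ.≤-trans 1≤m m≤k)))) ⟩
    (∑[ v ∈ words [1⋯ m ] k ] (parking? v ▸ insertionTerm k (pk v) (tie v) (suc r)))
      ≈⟨ ∑-max≤-PF k m (λ v → insertionTerm k (pk v) (tie v) (suc r)) m≤k ⟨
    (∑[ v ∈ filter (λ w → max 0 w ℕ.≤? m) (PF k) ] insertionTerm k (pk v) (tie v) (suc r))
      ≈⟨ 𝓘-∑-monomials k (suc r) (filter (λ w → max 0 w ℕ.≤? m) (PF k)) pk tie ⟨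
    𝓘 k (suc r) (H k m) ∎

  insertions-vanish : ∀ m k r → k < m → ∑-insertions-words [1⋯ m ] (suc m) parkingMonomial k (suc r) ≈ 0#
  insertions-vanish m k r k<m = K.trans
    (∑-words-cong [1⋯ m ] k λ where
      v refl v∈ → ∑-insertions-parking-0 (suc m) r v monomial (All.map (ℕ.m≤n⇒m≤1+n ∘ ∈-[1⋯]⇒≤) v∈) (s≤s k<m))
    (∑-0 (words [1⋯ m ] k) λ _ → K.refl)

  recursion : ∀ n m → 2 ≤ m → m ≤ n →
    H n m ≈ H n (m ∸ 1) + (∑[ r ∈ [1⋯ n ∸ m +ℕ 1 ] ] 𝓘 (n ∸ r) r (H (n ∸ r) (m ∸ 1)))
  recursion (suc n) (suc m) (s≤s 1≤m) (s≤s m≤n) = begin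
    H (suc n) (suc m)
      ≈⟨ H-words (suc n) (suc m) (s≤s m≤n) ⟩
    (∑[ w ∈ words [1⋯ suc m ] (suc n) ] parkingMonomial w)
      ≡⟨ ≡.cong (λ as → ∑[ w ∈ words as (suc n) ] parkingMonomial w) ([1⋯suc]-∷ʳ m) ⟩
    (∑[ w ∈ words ([1⋯ m ] ++ [ suc m ]) (suc n) ] parkingMonomial w)
      ≈⟨ ∑-words-∷ʳ [1⋯ m ] (suc m) (suc n) parkingMonomial ⟩
    -- The antidiagonal at `suc n` unfolds into the words without the letter `suc m` and those with
    -- `suc r` ≥ 1 copies of it.
    (∑[ w ∈ words [1⋯ m ] (suc n) ] parkingMonomial w) +
      antidiagonal (λ k r → ∑-insertions-words [1⋯ m ] (suc m) parkingMonomial k (suc r)) n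
      ≈⟨ K.+-cong (K.sym (H-words (suc n) m (ℕ.m≤n⇒m≤1+n m≤n)))
           (antidiagonal-truncate m (insertions-vanish m) (λ k r → insertions-𝓘 m k r 1≤m) n) ⟩
    H (suc n) m + (∑[ r ∈ upTo (suc n ∸ m) ] 𝓘 (n ∸ r) (suc r) (H (n ∸ r) m))
      -- The index is one less than the number of inserted letters; the last step below shifts it to
      -- start at 1.
      ≡⟨ ≡.cong (λ x → H (suc n) m + (∑[ r ∈ upTo x ] 𝓘 (n ∸ r) (suc r) (H (n ∸ r) m)))
           (≡.trans (ℕ.+-∸-assoc 1 m≤n) (ℕ.+-comm 1 (n ∸ m))) ⟩
    H (suc n) m + (∑[ r ∈ upTo (n ∸ m +ℕ 1) ] 𝓘 (n ∸ r) (suc r) (H (n ∸ r) m))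
      ≡⟨ ≡.cong (H (suc n) m +_) (∑-map suc (upTo (n ∸ m +ℕ 1)) (λ r → 𝓘 (suc n ∸ r) r (H (suc n ∸ r) m))) ⟨
    H (suc n) m + (∑[ r ∈ [1⋯ n ∸ m +ℕ 1 ] ] 𝓘 (suc n ∸ r) r (H (suc n ∸ r) m)) ∎

  initial : ∀ n → 1 ≤ n → H n 1 ≈ u ^ (n ∸ 1)
  initial n 1≤n = begin
    H n 1
      ≈⟨ H-words n 1 1≤n ⟩
    (∑[ w ∈ words [ 1 ] n ] parkingMonomial w)
      -- `[1⋯ 1]` computes to `[ 1 ]`, so the constant word is the only one.
      ≈⟨ ∑-words-singleton 1 n parkingMonomial ⟩
    parkingMonomial (replicate n 1)
      ≈⟨ ▸-yes (parking? (replicate n 1)) (monomial (replicate n 1)) (parking-replicate-1 n) ⟩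
    t ^ pk (replicate n 1) * u ^ tie (replicate n 1)
      ≡⟨ ≡.cong₂ (λ p q → t ^ p * u ^ q) (pk-replicate n 1) (tie-replicate n 1) ⟩
    t ^ 0 * u ^ (n ∸ 1)
      ≈⟨ K.*-identityˡ (u ^ (n ∸ 1)) ⟩
    u ^ (n ∸ 1) ∎
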